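{- Let $d\ge1$ and $f_d(0,0,x)=\sum_{k=0}^{d-1}C_{d-1-k}\binom{d-1-k}{k}(1-x)^kx^{d-k}$, where $C_n=\frac1{n+1}\binom{2n}{n}$. Then for every $k$, the coefficient of $x^{d-k}$ in $f_d(0,0,x)$ equals the number of plane trees on $d$ vertices with exactly $k$ type $(0)$ special vertices.
   Context: A plane tree is a rooted tree whose children at each vertex are linearly ordered left to right; a vertex $v$ is a type $(0)$ special vertex if $v$ is a leaf, $v$ is the leftmost child of its parent, and the parent of $v$ is not the root. ($f_d(0,0,x)$ is Stanley's toric $f$-polynomial of the face poset of a $(d-1)$-dimensional cube, i.e. the contribution of the first facet in a cubical shelling.) -}

module Defs where

open import Data.Nat using (ℕ; zero; suc; _+_; _*_; _∸_; _<_)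
open import Data.Nat.DivMod using (_/_)
open import Data.Nat.Combinatorics using (_C_)
open import Data.Integer as ℤ using (ℤ; +_; -[1+_])
open import Data.List using (List; []; _∷_)

-- Univariate polynomials with integer coefficients, as coefficient
-- lists: the i-th entry is the coefficient of x^i.

Poly : Set
Poly = List ℤ

_⊕_ : Poly → Poly → Poly
[] ⊕ q = q
(a ∷ p) ⊕ [] = a ∷ p
(a ∷ p) ⊕ (b ∷ q) = (a ℤ.+ b) ∷ (p ⊕ q)

scale : ℤ → Poly → Poly
scale c [] = []
scale c (a ∷ p) = (c ℤ.* a) ∷ scale c p

_⊗_ : Poly → Poly → Poly
[] ⊗ q = []
(a ∷ p) ⊗ q = scale a q ⊕ (+ 0 ∷ (p ⊗ q))

const : ℤ → Poly
const c = c ∷ []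

X : Poly
X = + 0 ∷ + 1 ∷ []

oneMinusX : Poly
oneMinusX = + 1 ∷ -[1+ 0 ] ∷ []

_^ᵖ_ : Poly → ℕ → Poly
p ^ᵖ zero = const (+ 1)
p ^ᵖ suc n = p ⊗ (p ^ᵖ n)

coeff : Poly → ℕ → ℤ
coeff [] i = + 0
coeff (a ∷ p) zero = a
coeff (a ∷ p) (suc i) = coeff p i

coeffℤ : Poly → ℤ → ℤ
coeffℤ p (+ n) = coeff p n
coeffℤ p -[1+ n ] = + 0

polySum : ℕ → (ℕ → Poly) → Poly
polySum zero f = []
polySum (suc n) f = polySum n f ⊕ f n

catalan : ℕ → ℕ
catalan n = ((2 * n) C n) / suc n

fd00 : ℕ → Poly
fd00 d = polySum d (λ k →
  const (+ (catalan (d ∸ 1 ∸ k) * ((d ∸ 1 ∸ k) C k)))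
    ⊗ ((oneMinusX ^ᵖ k) ⊗ (X ^ᵖ (d ∸ k))))

-- Plane trees: a vertex together with the ordered (left-to-right) list
-- of its subtrees.

data PlaneTree : Set where
  node : List PlaneTree → PlaneTree

mutual
  size : PlaneTree → ℕ
  size (node cs) = suc (sizes cs)

  sizes : List PlaneTree → ℕ
  sizes [] = 0
  sizes (t ∷ ts) = size t + sizes ts

leftmostLeaf : List PlaneTree → ℕ
leftmostLeaf [] = 0
leftmostLeaf (node [] ∷ _) = 1
leftmostLeaf (node (_ ∷ _) ∷ _) = 0

mutual
  -- For a NON-ROOT vertex v with subtree t: the number of type (0)
  -- special vertices among the proper descendants of v.  A child of v
  -- is special iff it is a leaf and the leftmost child (v is not the root).
  specialBelow : PlaneTree → ℕ
  specialBelow (node cs) = leftmostLeaf cs + specialBelows cs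

  specialBelows : List PlaneTree → ℕ
  specialBelows [] = 0
  specialBelows (t ∷ ts) = specialBelow t + specialBelows ts

-- number of type (0) special vertices of a plane tree: the root is never
-- special, and children of the root are not special (their parent is the root).
special0 : PlaneTree → ℕ
special0 (node cs) = specialBelows cs

module Submission where

-- Write count N R K for the number of plane forests with N vertices, R
-- trees and K special vertices (leftmost leaf children of non-root
-- vertices).  A tree on n+1 vertices is a root above a forest on n
-- vertices, so the trees to be counted number ∑_R count n R k.
--
-- Moments shows, for any counting function obeying
-- two recurrences, that its binomial moments ∑_K C(K,j) count N R K solve
-- a recurrence whose unique solution is forestNum (N-j) R · C(N-j,j);
-- summing over R and inverting yields the coefficient formula.

open import Defs
open import Data.Nat using (ℕ; _≥_; _≤_)
open import Data.Integer using (ℤ; +_; _-_)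
open import Data.Fin using (Fin)
open import Data.Product using (Σ; ∃; _×_)
open import Function.Bundles using (_↔_)
open import Relation.Binary.PropositionalEquality using (_≡_)
open import Data.Nat using (suc)
open import Data.Product using (_,_)
open import Relation.Binary.PropositionalEquality using (trans; sym)

module Binomials where

  open import Data.Nat
  open import Data.Nat.Properties
  open import Data.Nat.Tactic.RingSolver using (solve-∀)
  open import Data.Nat.Combinatorics using (_C_; nCk+nC[k+1]≡[n+1]C[k+1]; nCk≡nC[n∸k])
  open import Data.Nat.DivMod using (_/_; m*n/n≡m)
  open import Relation.Binary.PropositionalEquality
  open import Data.Sum using (inj₁; inj₂)
  open import Data.Product using (_,_)
  open ≡-Reasoning

  -- Binomial coefficients defined by Pascal's rule, the form in which
  -- every induction below uses them.
  binom : ℕ → ℕ → ℕ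
  binom n zero = 1
  binom zero (suc k) = 0
  binom (suc n) (suc k) = binom n k + binom n (suc k)

  binom≡C : ∀ n k → binom n k ≡ n C k
  binom≡C n zero = refl
  binom≡C zero (suc k) = refl
  binom≡C (suc n) (suc k) =
    trans (cong₂ _+_ (binom≡C n k) (binom≡C n (suc k))) (nCk+nC[k+1]≡[n+1]C[k+1] n k)

  binom-vanish : ∀ {n k} → n < k → binom n k ≡ 0
  binom-vanish {zero} {suc k} _ = refl
  binom-vanish {suc n} {suc k} (s≤s n<k) =
    cong₂ _+_ (binom-vanish n<k) (binom-vanish (m<n⇒m<1+n n<k))

  binom-sym : ∀ {n k} → k ≤ n → binom n k ≡ binom n (n ∸ k)
  binom-sym {n} {k} k≤n =
    trans (binom≡C n k) (trans (nCk≡nC[n∸k] k≤n) (sym (binom≡C n (n ∸ k))))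

  binom-one : ∀ n → binom n 1 ≡ n
  binom-one zero = refl
  binom-one (suc n) = cong suc (binom-one n)

  binom-absorb : ∀ n k → suc k * binom n (suc k) + k * binom n k ≡ n * binom n k
  binom-absorb zero zero = refl
  binom-absorb zero (suc k) = cong₂ _+_ (*-zeroʳ (suc (suc k))) (*-zeroʳ (suc k))
  binom-absorb (suc n) zero = begin
    1 * binom (suc n) 1 + 0  ≡⟨ +-identityʳ _ ⟩
    binom (suc n) 1 + 0      ≡⟨ +-identityʳ _ ⟩
    binom (suc n) 1          ≡⟨ binom-one (suc n) ⟩
    suc n                    ≡⟨ *-identityʳ (suc n) ⟨
    suc n * 1                ∎
  binom-absorb (suc n) (suc k) = begin
    suc (suc k) * (b₁ + b₂) + suc k * (b₀ + b₁)
      ≡⟨ regroup k b₀ b₁ b₂ ⟩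
    (suc (suc k) * b₂ + suc k * b₁) + (suc k * b₁ + k * b₀) + b₁ + b₀
      ≡⟨ cong₂ (λ x y → x + y + b₁ + b₀) (binom-absorb n (suc k)) (binom-absorb n k) ⟩
    n * b₁ + n * b₀ + b₁ + b₀
      ≡⟨ collect n b₀ b₁ ⟩
    suc n * (b₀ + b₁) ∎
    where
    b₀ = binom n k
    b₁ = binom n (suc k)
    b₂ = binom n (suc (suc k))
    regroup : ∀ k b₀ b₁ b₂ → suc (suc k) * (b₁ + b₂) + suc k * (b₀ + b₁)
            ≡ (suc (suc k) * b₂ + suc k * b₁) + (suc k * b₁ + k * b₀) + b₁ + b₀
    regroup = solve-∀
    collect : ∀ n b₀ b₁ → n * b₁ + n * b₀ + b₁ + b₀ ≡ suc n * (b₀ + b₁)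
    collect = solve-∀

  shiftℕ : (ℕ → ℕ) → ℕ → ℕ
  shiftℕ f zero = 0
  shiftℕ f (suc k) = f k

  -- binom₋ n k = C(n, k-1); Pascal's rule then reads
  -- C(n+1, k) = C(n, k-1) + C(n, k) uniformly in k.
  binom₋ : ℕ → ℕ → ℕ
  binom₋ n = shiftℕ (binom n)

  pascal : ∀ n k → binom (suc n) k ≡ binom₋ n k + binom n k
  pascal n zero = refl
  pascal n (suc k) = refl

  -- Ballot numbers: ballot E R = C(2E+R, E) - C(2E+R, E-1) (ballot-closed).
  -- Their recursion is structural in (E, R) lexicographically; the forest
  -- numbers below are defined through them for that reason.
  ballot : ℕ → ℕ → ℕ
  ballot zero R = 1
  ballot (suc E) zero = ballot E 1
  ballot (suc E) (suc R) = ballot (suc E) R + ballot E (suc (suc R))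

  ballot-closed : ∀ E R N → N ≡ E + E + R → ballot E R + binom₋ N E ≡ binom N E
  ballot-closed zero R N _ = refl
  ballot-closed (suc E) zero zero ()
  ballot-closed (suc E) zero (suc N) N+1≡ = begin
    ballot E 1 + binom₋ (suc N) (suc E)   ≡⟨ cong (_+_ (ballot E 1)) (pascal N E) ⟩
    ballot E 1 + (binom₋ N E + binom N E) ≡⟨ +-assoc (ballot E 1) _ _ ⟨
    ballot E 1 + binom₋ N E + binom N E   ≡⟨ cong (_+ binom N E) (ballot-closed E 1 N N≡) ⟩
    binom N E + binom N E                 ≡⟨ cong (_+_ (binom N E)) middle ⟩
    binom N E + binom N (suc E)           ∎
    where
    N≡ : N ≡ E + E + 1
    N≡ = suc-injective (trans N+1≡ (arith E))
      where arith : ∀ E → suc E + suc E + 0 ≡ suc (E + E + 1)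
            arith = solve-∀
    -- N = 2E + 1, so C(N, E) = C(N, E+1)
    middle : binom N E ≡ binom N (suc E)
    middle = begin
      binom N E              ≡⟨ cong (binom N) (m+n∸m≡n (suc E) E) ⟨
      binom N (suc E + E ∸ suc E) ≡⟨ cong (λ y → binom N (y ∸ suc E)) (trans (arith E) (sym N≡)) ⟩
      binom N (N ∸ suc E)    ≡⟨ binom-sym (subst (suc E ≤_) (sym N≡) (arith′ E)) ⟨
      binom N (suc E)        ∎
      where arith : ∀ E → suc E + E ≡ E + E + 1
            arith = solve-∀
            arith′ : ∀ E → suc E ≤ E + E + 1
            arith′ E = ≤-trans (m≤m+n (suc E) E) (≤-reflexive (arith E))
  ballot-closed (suc E) (suc R) zero ()
  ballot-closed (suc E) (suc R) (suc N) N+1≡ = begin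
    (ballot (suc E) R + ballot E (suc (suc R))) + binom₋ (suc N) (suc E)
      ≡⟨ cong (_+_ (ballot (suc E) R + ballot E (suc (suc R)))) (pascal N E) ⟩
    (ballot (suc E) R + ballot E (suc (suc R))) + (binom₋ N E + binom N E)
      ≡⟨ interchange (ballot (suc E) R) (ballot E (suc (suc R))) (binom₋ N E) (binom N E) ⟩
    (ballot (suc E) R + binom N E) + (ballot E (suc (suc R)) + binom₋ N E)
      ≡⟨ cong₂ _+_ (ballot-closed (suc E) R N (trans N≡ (arith₁ E R))) (ballot-closed E (suc (suc R)) N N≡) ⟩
    binom N (suc E) + binom N E
      ≡⟨ +-comm (binom N (suc E)) (binom N E) ⟩
    binom N E + binom N (suc E) ∎
    where
    arith₀ : ∀ E R → suc E + suc E + suc R ≡ suc (E + E + suc (suc R))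
    arith₀ = solve-∀
    arith₁ : ∀ E R → E + E + suc (suc R) ≡ suc E + suc E + R
    arith₁ = solve-∀
    interchange : ∀ a b c d → (a + b) + (c + d) ≡ (a + d) + (b + c)
    interchange = solve-∀
    N≡ : N ≡ E + E + suc (suc R)
    N≡ = suc-injective (trans N+1≡ (arith₀ E R))

  ballot-catalan : ∀ M → suc M * ballot M 0 ≡ binom (M + M) M
  ballot-catalan zero = refl
  ballot-catalan (suc M) = +-cancelʳ-≡ (suc M * b) _ _ (begin
    suc (suc M) * g + suc M * b        ≡⟨ cong (_+_ (suc (suc M) * g)) (sym c-vs-b) ⟩
    suc (suc M) * g + suc (suc M) * c  ≡⟨ *-distribˡ-+ (suc (suc M)) g c ⟨
    suc (suc M) * (g + c)              ≡⟨ cong (suc (suc M) *_) g+c≡b ⟩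
    suc (suc M) * b                    ∎)
    where
    N = suc M + suc M
    b = binom N (suc M)
    c = binom N M
    g = ballot (suc M) 0
    g+c≡b : g + c ≡ b
    g+c≡b = ballot-closed (suc M) 0 N (sym (+-identityʳ N))
    -- C(2M+2, M) = C(2M+2, M+2), then absorption gives (M+2) c = (M+1) b
    c≡ : c ≡ binom N (suc (suc M))
    c≡ = trans (binom-sym (≤-trans (n≤1+n M) (m≤m+n (suc M) (suc M)))) (cong (binom N) (N∸M M))
      where N∸M : ∀ M → suc M + suc M ∸ M ≡ suc (suc M)
            N∸M M = begin
              suc M + suc M ∸ M       ≡⟨ cong (_∸ M) (rearrange M) ⟩
              suc (suc M) + M ∸ M     ≡⟨ m+n∸n≡m (suc (suc M)) M ⟩
              suc (suc M)             ∎
              where rearrange : ∀ M → suc M + suc M ≡ suc (suc M) + M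
                    rearrange = solve-∀
    c-vs-b : suc (suc M) * c ≡ suc M * b
    c-vs-b = +-cancelʳ-≡ _ _ _ (begin
      suc (suc M) * c + suc M * b                  ≡⟨ cong (λ z → suc (suc M) * z + suc M * b) c≡ ⟩
      suc (suc M) * binom N (suc (suc M)) + suc M * b ≡⟨ binom-absorb N (suc M) ⟩
      (suc M + suc M) * b                          ≡⟨ *-distribʳ-+ b (suc M) (suc M) ⟩
      suc M * b + suc M * b                        ∎)

  catalan≡ballot : ∀ M → catalan M ≡ ballot M 0
  catalan≡ballot M = begin
    ((2 * M) C M) / suc M           ≡⟨ cong (_/ suc M) (sym (binom≡C (2 * M) M)) ⟩
    binom (2 * M) M / suc M         ≡⟨ cong (λ z → binom (M + z) M / suc M) (+-identityʳ M) ⟩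
    binom (M + M) M / suc M         ≡⟨ cong (_/ suc M) (trans (*-comm (ballot M 0) (suc M)) (ballot-catalan M)) ⟨
    (ballot M 0 * suc M) / suc M    ≡⟨ m*n/n≡m (ballot M 0) (suc M) ⟩
    ballot M 0                      ∎

  ballotAt : ℕ → ℕ → ℕ → ℕ
  ballotAt M zero R₀ = ballot M R₀
  ballotAt zero (suc R) R₀ = 0
  ballotAt (suc M) (suc R) R₀ = ballotAt M R R₀

  -- Combinatorially
  -- forestNum M R counts plane forests with M vertices and R trees; the
  -- proof only uses the boundary values and the recurrence forestNum-step.
  forestNum : ℕ → ℕ → ℕ
  forestNum zero zero = 1
  forestNum (suc M) zero = 0
  forestNum zero (suc R) = 0
  forestNum (suc M) (suc R) = ballotAt M R R

  ballotAt-+ : ∀ R E R₀ → ballotAt (R + E) R R₀ ≡ ballot E R₀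
  ballotAt-+ zero E R₀ = refl
  ballotAt-+ (suc R) E R₀ = ballotAt-+ R E R₀

  ballotAt-vanish : ∀ {M R} R₀ → M < R → ballotAt M R R₀ ≡ 0
  ballotAt-vanish {zero} {suc R} R₀ _ = refl
  ballotAt-vanish {suc M} {suc R} R₀ (s≤s M<R) = ballotAt-vanish R₀ M<R

  -- a forest has at least as many vertices as trees
  forestNum-vanish : ∀ {M R} → M < R → forestNum M R ≡ 0
  forestNum-vanish {zero} {suc R} _ = refl
  forestNum-vanish {suc M} {suc R} (s≤s M<R) = ballotAt-vanish R M<R

  -- Removing the root of the first tree turns its children into trees:
  -- F(L+1, R+1) = F(L, R) + F(L+1, R+2).
  forestNum-step : ∀ L R → forestNum (suc L) (suc R) ≡ forestNum L R + forestNum (suc L) (suc (suc R))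
  forestNum-step L R with ≤-<-connex R L
  ... | inj₂ L<R = trans (ballotAt-vanish R L<R)
        (sym (cong₂ _+_ (forestNum-vanish L<R) (ballotAt-vanish (suc R) (m<n⇒m<1+n L<R))))
  ... | inj₁ R≤L with m≤n⇒∃[o]m+o≡n R≤L
  ...   | E , refl = step R E
    where
    step : ∀ R E → forestNum (suc (R + E)) (suc R) ≡ forestNum (R + E) R + forestNum (suc (R + E)) (suc (suc R))
    step zero zero = refl
    step zero (suc E) = refl
    step (suc R) zero = begin
      ballotAt (R + 0) R (suc R)   ≡⟨ ballotAt-+ R 0 (suc R) ⟩
      1                            ≡⟨ ballotAt-+ R 0 R ⟨
      ballotAt (R + 0) R R         ≡⟨ +-identityʳ _ ⟨
      ballotAt (R + 0) R R + 0     ≡⟨ cong (_+_ (ballotAt (R + 0) R R)) (ballotAt-vanish (suc (suc R)) (s≤s (≤-reflexive (+-identityʳ R)))) ⟨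
      ballotAt (R + 0) R R + ballotAt (R + 0) (suc R) (suc (suc R)) ∎
    step (suc R) (suc E) = begin
      ballotAt (R + suc E) R (suc R)
        ≡⟨ ballotAt-+ R (suc E) (suc R) ⟩
      ballot (suc E) R + ballot E (suc (suc R))
        ≡⟨ cong₂ _+_ (ballotAt-+ R (suc E) R) (trans (cong (λ z → ballotAt z (suc R) (suc (suc R))) (+-suc R E)) (ballotAt-+ R E (suc (suc R)))) ⟨
      ballotAt (R + suc E) R R + ballotAt (R + suc E) (suc R) (suc (suc R)) ∎

module Sums where

  open import Data.Nat as ℕ using (ℕ; zero; suc; _≤_; _<_; z≤n; s≤s; _∸_)
  import Data.Nat.Properties as ℕ
  open import Data.Integer using (ℤ; +_; -_; _+_; _*_; _-_; 0ℤ; 1ℤ)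
  open import Data.Integer.Properties
  open import Data.Integer.Tactic.RingSolver using (solve-∀)
  open import Relation.Binary.PropositionalEquality
  open import Data.Sum using (inj₁; inj₂)
  open import Relation.Nullary using (contradiction)
  open import Function using (_∘_)
  open Binomials using (binom; binom-vanish)
  open ≡-Reasoning

  ∑ : ℕ → (ℕ → ℤ) → ℤ
  ∑ zero f = 0ℤ
  ∑ (suc n) f = f 0 + ∑ n (f ∘ suc)

  syntax ∑ n (λ i → e) = ∑[ i < n ] e

  ∑-cong : ∀ n {f g : ℕ → ℤ} → (∀ i → i < n → f i ≡ g i) → ∑ n f ≡ ∑ n g
  ∑-cong zero _ = refl
  ∑-cong (suc n) f≡g = cong₂ _+_ (f≡g 0 (s≤s z≤n)) (∑-cong n (λ i i<n → f≡g (suc i) (s≤s i<n)))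

  ∑-cong′ : ∀ n {f g : ℕ → ℤ} → (∀ i → f i ≡ g i) → ∑ n f ≡ ∑ n g
  ∑-cong′ n f≡g = ∑-cong n (λ i _ → f≡g i)

  ∑-zero : ∀ n {f : ℕ → ℤ} → (∀ i → i < n → f i ≡ 0ℤ) → ∑ n f ≡ 0ℤ
  ∑-zero zero _ = refl
  ∑-zero (suc n) f≡0 = cong₂ _+_ (f≡0 0 (s≤s z≤n)) (∑-zero n (λ i i<n → f≡0 (suc i) (s≤s i<n)))

  ∑-+ : ∀ n (f g : ℕ → ℤ) → ∑[ i < n ] (f i + g i) ≡ ∑ n f + ∑ n g
  ∑-+ zero f g = refl
  ∑-+ (suc n) f g = begin
    (f 0 + g 0) + ∑[ i < n ] (f (suc i) + g (suc i))       ≡⟨ cong (_+_ (f 0 + g 0)) (∑-+ n (f ∘ suc) (g ∘ suc)) ⟩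
    (f 0 + g 0) + (∑ n (f ∘ suc) + ∑ n (g ∘ suc))         ≡⟨ interchange (f 0) (g 0) _ _ ⟩
    (f 0 + ∑ n (f ∘ suc)) + (g 0 + ∑ n (g ∘ suc))         ∎
    where interchange : ∀ a b c d → (a + b) + (c + d) ≡ (a + c) + (b + d)
          interchange = solve-∀

  ∑-neg : ∀ n (f : ℕ → ℤ) → ∑[ i < n ] (- f i) ≡ - ∑ n f
  ∑-neg zero f = refl
  ∑-neg (suc n) f =
    trans (cong (_+_ (- f 0)) (∑-neg n (f ∘ suc))) (sym (neg-distrib-+ (f 0) (∑ n (f ∘ suc))))

  ∑-- : ∀ n (f g : ℕ → ℤ) → ∑[ i < n ] (f i - g i) ≡ ∑ n f - ∑ n g
  ∑-- n f g = trans (∑-+ n f (λ i → - g i)) (cong (_+_ (∑ n f)) (∑-neg n g))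

  ∑-*ˡ : ∀ n c (f : ℕ → ℤ) → c * ∑ n f ≡ ∑[ i < n ] (c * f i)
  ∑-*ˡ zero c f = *-zeroʳ c
  ∑-*ˡ (suc n) c f = trans (*-distribˡ-+ c (f 0) _) (cong (_+_ (c * f 0)) (∑-*ˡ n c (f ∘ suc)))

  ∑-*ʳ : ∀ n (f : ℕ → ℤ) c → ∑ n f * c ≡ ∑[ i < n ] (f i * c)
  ∑-*ʳ n f c = trans (*-comm (∑ n f) c) (trans (∑-*ˡ n c f) (∑-cong′ n (λ i → *-comm c (f i))))

  ∑-snoc : ∀ n (f : ℕ → ℤ) → ∑ (suc n) f ≡ ∑ n f + f n
  ∑-snoc zero f = trans (+-identityʳ (f 0)) (sym (+-identityˡ (f 0)))
  ∑-snoc (suc n) f = trans (cong (_+_ (f 0)) (∑-snoc n (f ∘ suc))) (sym (+-assoc (f 0) _ _))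

  ∑-truncate : ∀ {a b} {f : ℕ → ℤ} → a ≤ b → (∀ i → a ≤ i → f i ≡ 0ℤ) → ∑ b f ≡ ∑ a f
  ∑-truncate {zero} {b} _ f≡0 = ∑-zero b (λ i _ → f≡0 i z≤n)
  ∑-truncate {suc a} {suc b} {f} (s≤s a≤b) f≡0 =
    cong (_+_ (f 0)) (∑-truncate a≤b (λ i a≤i → f≡0 (suc i) (s≤s a≤i)))

  ∑-swap : ∀ n m (f : ℕ → ℕ → ℤ) → ∑[ i < n ] ∑[ j < m ] f i j ≡ ∑[ j < m ] ∑[ i < n ] f i j
  ∑-swap zero m f = sym (∑-zero m (λ _ _ → refl))
  ∑-swap (suc n) m f = begin
    ∑[ j < m ] f 0 j + ∑[ i < n ] ∑[ j < m ] f (suc i) j    ≡⟨ cong (_+_ (∑[ j < m ] f 0 j)) (∑-swap n m (f ∘ suc)) ⟩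
    ∑[ j < m ] f 0 j + ∑[ j < m ] ∑[ i < n ] f (suc i) j    ≡⟨ ∑-+ m (f 0) (λ j → ∑[ i < n ] f (suc i) j) ⟨
    ∑[ j < m ] (f 0 j + ∑[ i < n ] f (suc i) j)             ∎

  δ : ℕ → ℕ → ℤ
  δ zero zero = 1ℤ
  δ zero (suc e) = 0ℤ
  δ (suc t) zero = 0ℤ
  δ (suc t) (suc e) = δ t e

  δ-refl : ∀ c → δ c c ≡ 1ℤ
  δ-refl zero = refl
  δ-refl (suc c) = δ-refl c

  δ-≢ : ∀ {a b} → a ≢ b → δ a b ≡ 0ℤ
  δ-≢ {zero} {zero} a≢b = contradiction refl a≢b
  δ-≢ {zero} {suc b} _ = refl
  δ-≢ {suc a} {zero} _ = refl
  δ-≢ {suc a} {suc b} a≢b = δ-≢ (a≢b ∘ cong suc)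

  ∑-δ : ∀ n c (f : ℕ → ℤ) → c < n → ∑[ i < n ] (δ i c * f i) ≡ f c
  ∑-δ (suc n) zero f _ = begin
    1ℤ * f 0 + ∑[ i < n ] (0ℤ * f (suc i))  ≡⟨ cong₂ _+_ (*-identityˡ (f 0)) (∑-zero n (λ i _ → *-zeroˡ (f (suc i)))) ⟩
    f 0 + 0ℤ                                ≡⟨ +-identityʳ (f 0) ⟩
    f 0                                     ∎
  ∑-δ (suc n) (suc c) f (s≤s c<n) =
    trans (cong₂ _+_ (*-zeroˡ (f 0)) (∑-δ n c (f ∘ suc) c<n)) (+-identityˡ (f (suc c)))

  ∑-δ-out : ∀ n c (f : ℕ → ℤ) → n ≤ c → ∑[ i < n ] (δ i c * f i) ≡ 0ℤ
  ∑-δ-out n c f n≤c = ∑-zero n (λ i i<n →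
    trans (cong (_* f i) (δ-≢ (ℕ.<⇒≢ (ℕ.<-≤-trans i<n n≤c)))) (*-zeroˡ (f i)))

  -- Signed binomials σ m k = (-1)^(m-k) C(m,k): the inverse of the
  -- binomial matrix (binomial-inversion).
  sgn : ℕ → ℤ
  sgn zero = 1ℤ
  sgn (suc n) = - sgn n

  σ : ℕ → ℕ → ℤ
  σ m k = sgn (m ∸ k) * + binom m k

  shift : (ℕ → ℤ) → ℕ → ℤ
  shift f zero = 0ℤ
  shift f (suc k) = f k

  σ-step : ∀ m k → σ (suc m) k ≡ shift (σ m) k - σ m k
  σ-step m zero = begin
    - sgn m * + 1          ≡⟨ *-identityʳ (- sgn m) ⟩
    - sgn m                ≡⟨ cong -_ (*-identityʳ (sgn m)) ⟨
    - (sgn m * + 1)        ≡⟨ +-identityˡ _ ⟨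
    0ℤ - σ m 0             ∎
  σ-step m (suc k) = begin
    sgn (m ∸ k) * + (binom m k ℕ.+ binom m (suc k))
      ≡⟨ cong (sgn (m ∸ k) *_) (pos-+ (binom m k) (binom m (suc k))) ⟩
    sgn (m ∸ k) * (+ binom m k + + binom m (suc k))
      ≡⟨ *-distribˡ-+ (sgn (m ∸ k)) (+ binom m k) (+ binom m (suc k)) ⟩
    σ m k + sgn (m ∸ k) * + binom m (suc k)
      ≡⟨ cong (_+_ (σ m k)) sign-flip ⟩
    σ m k - σ m (suc k) ∎
    where
    sign-flip : sgn (m ∸ k) * + binom m (suc k) ≡ - σ m (suc k)
    sign-flip with ℕ.<-≤-connex k m
    ... | inj₁ k<m = begin
      sgn (m ∸ k) * + binom m (suc k)           ≡⟨ cong (λ z → sgn z * + binom m (suc k)) (∸-suc k<m) ⟩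
      - sgn (m ∸ suc k) * + binom m (suc k)     ≡⟨ neg-distribˡ-* (sgn (m ∸ suc k)) _ ⟨
      - σ m (suc k)                             ∎
      where ∸-suc : ∀ {m k} → k < m → m ∸ k ≡ suc (m ∸ suc k)
            ∸-suc {suc m} {zero} _ = refl
            ∸-suc {suc m} {suc k} (s≤s k<m) = ∸-suc k<m
    ... | inj₂ m≤k rewrite binom-vanish (s≤s m≤k) =
      trans (*-zeroʳ (sgn (m ∸ k))) (cong -_ (sym (*-zeroʳ (sgn (m ∸ suc k)))))

  binomσ : ℕ → ℕ → ℤ
  binomσ K k = ∑[ m < suc K ] (+ binom K m * σ m k)

  -- by σ-step, moving to σ(m+1, ·) shifts a row of the product
  binomσ-step : ∀ K k → ∑[ m < suc K ] (+ binom K m * σ (suc m) k) ≡ shift (binomσ K) k - binomσ K k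
  binomσ-step K k = begin
    ∑[ m < suc K ] (+ binom K m * σ (suc m) k)
      ≡⟨ ∑-cong′ (suc K) (λ m → cong (+ binom K m *_) (σ-step m k)) ⟩
    ∑[ m < suc K ] (+ binom K m * (shift (σ m) k - σ m k))
      ≡⟨ ∑-cong′ (suc K) (λ m → distrib (+ binom K m) (shift (σ m) k) (σ m k)) ⟩
    ∑[ m < suc K ] (+ binom K m * shift (σ m) k - + binom K m * σ m k)
      ≡⟨ ∑-- (suc K) (λ m → + binom K m * shift (σ m) k) (λ m → + binom K m * σ m k) ⟩
    ∑[ m < suc K ] (+ binom K m * shift (σ m) k) - binomσ K k
      ≡⟨ cong (_- binomσ K k) (shifted k) ⟩
    shift (binomσ K) k - binomσ K k ∎
    where
    distrib : ∀ a b c → a * (b - c) ≡ a * b - a * c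
    distrib = solve-∀
    shifted : ∀ k → ∑[ m < suc K ] (+ binom K m * shift (σ m) k) ≡ shift (binomσ K) k
    shifted zero = ∑-zero (suc K) (λ m _ → *-zeroʳ (+ binom K m))
    shifted (suc k) = refl

  binomial-inversion : ∀ K k → binomσ K k ≡ δ K k
  binomial-inversion zero k = trans (+-identityʳ _) (trans (*-identityˡ (σ 0 k)) (σ-zero k))
    where σ-zero : ∀ k → σ 0 k ≡ δ 0 k
          σ-zero zero = refl
          σ-zero (suc k) = refl
  binomial-inversion (suc K) k = begin
    + 1 * σ 0 k + ∑[ m < suc K ] (+ binom (suc K) (suc m) * σ (suc m) k)
      ≡⟨ cong (_+_ (+ 1 * σ 0 k)) (trans (∑-cong′ (suc K) pascal-split) (∑-+ (suc K) lower upper)) ⟩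
    + 1 * σ 0 k + (∑ (suc K) lower + ∑ (suc K) upper)
      ≡⟨ rotate (+ 1 * σ 0 k) (∑ (suc K) lower) (∑ (suc K) upper) ⟩
    ∑ (suc K) lower + (+ 1 * σ 0 k + ∑ (suc K) upper)
      ≡⟨ cong₂ _+_ (binomσ-step K k) upper-sum ⟩
    (shift (binomσ K) k - binomσ K k) + binomσ K k
      ≡⟨ cancel (shift (binomσ K) k) (binomσ K k) ⟩
    shift (binomσ K) k
      ≡⟨ shift-binomσ k ⟩
    δ (suc K) k ∎
    where
    lower upper : ℕ → ℤ
    lower m = + binom K m * σ (suc m) k
    upper m = + binom K (suc m) * σ (suc m) k
    pascal-split : ∀ m → + binom (suc K) (suc m) * σ (suc m) k ≡ lower m + upper m
    pascal-split m = trans (cong (_* σ (suc m) k) (pos-+ (binom K m) (binom K (suc m))))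
                           (*-distribʳ-+ (σ (suc m) k) (+ binom K m) (+ binom K (suc m)))
    -- the upper terms together with the m = 0 term form the row for K
    upper-sum : + 1 * σ 0 k + ∑ (suc K) upper ≡ binomσ K k
    upper-sum = ∑-truncate (ℕ.n≤1+n (suc K))
      (λ m K<m → trans (cong (λ z → + z * σ m k) (binom-vanish K<m)) (*-zeroˡ (σ m k)))
    shift-binomσ : ∀ k → shift (binomσ K) k ≡ δ (suc K) k
    shift-binomσ zero = refl
    shift-binomσ (suc k) = binomial-inversion K k
    rotate : ∀ a b c → a + (b + c) ≡ b + (a + c)
    rotate = solve-∀
    cancel : ∀ a b → (a - b) + b ≡ a
    cancel = solve-∀

  binomial-inversion′ : ∀ {B} K k → suc K ≤ B → ∑[ m < B ] (+ binom K m * σ m k) ≡ δ K k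
  binomial-inversion′ K k K<B = trans
    (∑-truncate K<B (λ m K<m → trans (cong (λ z → + z * σ m k) (binom-vanish K<m)) (*-zeroˡ (σ m k))))
    (binomial-inversion K k)

  invert-binomial-transform : ∀ B (s : ℕ → ℤ) → (∀ K → B ≤ K → s K ≡ 0ℤ) → ∀ k →
    ∑[ m < B ] (∑[ K < B ] (+ binom K m * s K) * σ m k) ≡ s k
  invert-binomial-transform B s s-support k = begin
    ∑[ m < B ] (∑[ K < B ] (+ binom K m * s K) * σ m k)
      ≡⟨ ∑-cong′ B (λ m → ∑-*ʳ B (λ K → + binom K m * s K) (σ m k)) ⟩
    ∑[ m < B ] ∑[ K < B ] (+ binom K m * s K * σ m k)
      ≡⟨ ∑-swap B B (λ m K → + binom K m * s K * σ m k) ⟩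
    ∑[ K < B ] ∑[ m < B ] (+ binom K m * s K * σ m k)
      ≡⟨ ∑-cong B (λ K K<B → trans (∑-cong′ B (λ m → reorder (+ binom K m) (s K) (σ m k)))
                              (trans (sym (∑-*ˡ B (s K) (λ m → + binom K m * σ m k)))
                                     (trans (cong (s K *_) (binomial-inversion′ K k K<B)) (*-comm (s K) (δ K k))))) ⟩
    ∑[ K < B ] (δ K k * s K)
      ≡⟨ pick ⟩
    s k ∎
    where
    reorder : ∀ b t u → b * t * u ≡ t * (b * u)
    reorder = solve-∀
    pick : ∑[ K < B ] (δ K k * s K) ≡ s k
    pick with ℕ.<-≤-connex k B
    ... | inj₁ k<B = ∑-δ B k s k<B
    ... | inj₂ B≤k = trans (∑-δ-out B k s B≤k) (sym (s-support k B≤k))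

module Coefficients where

  open import Data.Nat as ℕ using (ℕ; zero; suc; _≤_; _<_; z≤n; s≤s; _∸_)
  import Data.Nat.Properties as ℕ
  open import Data.Integer using (ℤ; +_; -_; _+_; _*_; _-_; 0ℤ; -1ℤ)
  open import Data.Integer.Properties
  open import Data.Integer.Tactic.RingSolver using (solve-∀)
  open import Relation.Binary.PropositionalEquality
  open import Data.Sum using (inj₁; inj₂)
  open import Data.List using ([]; _∷_)
  open import Function using (_∘_)
  open import Data.Nat.Combinatorics using (_C_)
  open Binomials using (binom; binom-vanish; binom-sym)
  open Sums
  open ≡-Reasoning

  coeff-⊕ : ∀ p q i → coeff (p ⊕ q) i ≡ coeff p i + coeff q i
  coeff-⊕ [] q i = sym (+-identityˡ _)
  coeff-⊕ (a ∷ p) [] i = sym (+-identityʳ _)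
  coeff-⊕ (a ∷ p) (b ∷ q) zero = refl
  coeff-⊕ (a ∷ p) (b ∷ q) (suc i) = coeff-⊕ p q i

  coeff-scale : ∀ c p i → coeff (scale c p) i ≡ c * coeff p i
  coeff-scale c [] i = sym (*-zeroʳ c)
  coeff-scale c (a ∷ p) zero = refl
  coeff-scale c (a ∷ p) (suc i) = coeff-scale c p i

  coeff-cons⊗-zero : ∀ a p q → coeff ((a ∷ p) ⊗ q) 0 ≡ a * coeff q 0
  coeff-cons⊗-zero a p q =
    trans (coeff-⊕ (scale a q) (+ 0 ∷ (p ⊗ q)) 0) (trans (+-identityʳ _) (coeff-scale a q 0))

  coeff-cons⊗-suc : ∀ a p q i → coeff ((a ∷ p) ⊗ q) (suc i) ≡ a * coeff q (suc i) + coeff (p ⊗ q) i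
  coeff-cons⊗-suc a p q i =
    trans (coeff-⊕ (scale a q) (+ 0 ∷ (p ⊗ q)) (suc i)) (cong (_+ coeff (p ⊗ q) i) (coeff-scale a q (suc i)))

  coeff-const⊗ : ∀ c q i → coeff (const c ⊗ q) i ≡ c * coeff q i
  coeff-const⊗ c q zero = coeff-cons⊗-zero c [] q
  coeff-const⊗ c q (suc i) = trans (coeff-cons⊗-suc c [] q i) (+-identityʳ _)

  coeff-⊗ : ∀ p q i → coeff (p ⊗ q) i ≡ ∑[ j < suc i ] (coeff p j * coeff q (i ∸ j))
  coeff-⊗ [] q i = sym (∑-zero (suc i) (λ j _ → *-zeroˡ (coeff q (i ∸ j))))
  coeff-⊗ (a ∷ p) q zero = trans (coeff-cons⊗-zero a p q) (sym (+-identityʳ _))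
  coeff-⊗ (a ∷ p) q (suc i) =
    trans (coeff-cons⊗-suc a p q i) (cong (_+_ (a * coeff q (suc i))) (coeff-⊗ p q i))

  coeff-polySum : ∀ n f i → coeff (polySum n f) i ≡ ∑[ m < n ] coeff (f m) i
  coeff-polySum zero f i = refl
  coeff-polySum (suc n) f i = begin
    coeff (polySum n f ⊕ f n) i              ≡⟨ coeff-⊕ (polySum n f) (f n) i ⟩
    coeff (polySum n f) i + coeff (f n) i    ≡⟨ cong (_+ coeff (f n) i) (coeff-polySum n f i) ⟩
    ∑[ m < n ] coeff (f m) i + coeff (f n) i ≡⟨ ∑-snoc n (λ m → coeff (f m) i) ⟨
    ∑[ m < suc n ] coeff (f m) i             ∎

  coeff-X^ : ∀ e t → coeff (X ^ᵖ e) t ≡ δ t e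
  coeff-X^ zero zero = refl
  coeff-X^ zero (suc t) = refl
  coeff-X^ (suc e) zero = trans (coeff-cons⊗-zero (+ 0) (+ 1 ∷ []) (X ^ᵖ e)) (*-zeroˡ (coeff (X ^ᵖ e) 0))
  coeff-X^ (suc e) (suc t) = begin
    coeff (X ⊗ (X ^ᵖ e)) (suc t)
      ≡⟨ coeff-cons⊗-suc 0ℤ (+ 1 ∷ []) (X ^ᵖ e) t ⟩
    0ℤ * coeff (X ^ᵖ e) (suc t) + coeff (const (+ 1) ⊗ (X ^ᵖ e)) t
      ≡⟨ cong₂ _+_ (*-zeroˡ (coeff (X ^ᵖ e) (suc t))) (coeff-const⊗ (+ 1) (X ^ᵖ e) t) ⟩
    0ℤ + + 1 * coeff (X ^ᵖ e) t
      ≡⟨ trans (+-identityˡ _) (*-identityˡ _) ⟩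
    coeff (X ^ᵖ e) t
      ≡⟨ coeff-X^ e t ⟩
    δ t e ∎

  coeff-1-X^ : ∀ m t → coeff (oneMinusX ^ᵖ m) t ≡ sgn t * + binom m t
  coeff-1-X^ zero zero = refl
  coeff-1-X^ zero (suc t) = sym (*-zeroʳ (sgn (suc t)))
  coeff-1-X^ (suc m) zero = begin
    coeff (oneMinusX ⊗ P) 0    ≡⟨ coeff-cons⊗-zero (+ 1) (-1ℤ ∷ []) P ⟩
    + 1 * coeff P 0            ≡⟨ *-identityˡ _ ⟩
    coeff P 0                  ≡⟨ coeff-1-X^ m 0 ⟩
    + 1 * + 1                  ∎
    where P = oneMinusX ^ᵖ m
  coeff-1-X^ (suc m) (suc t) = begin
    coeff (oneMinusX ⊗ P) (suc t)
      ≡⟨ coeff-cons⊗-suc (+ 1) (-1ℤ ∷ []) P t ⟩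
    + 1 * coeff P (suc t) + coeff (const -1ℤ ⊗ P) t
      ≡⟨ cong (_+_ (+ 1 * coeff P (suc t))) (coeff-const⊗ -1ℤ P t) ⟩
    + 1 * coeff P (suc t) + -1ℤ * coeff P t
      ≡⟨ cong₂ (λ u v → + 1 * u + -1ℤ * v) (coeff-1-X^ m (suc t)) (coeff-1-X^ m t) ⟩
    + 1 * (- sgn t * + binom m (suc t)) + -1ℤ * (sgn t * + binom m t)
      ≡⟨ collect (sgn t) (+ binom m t) (+ binom m (suc t)) ⟩
    - sgn t * (+ binom m t + + binom m (suc t))
      ≡⟨ cong (- sgn t *_) (pos-+ (binom m t) (binom m (suc t))) ⟨
    - sgn t * + binom (suc m) (suc t) ∎
    where
    P = oneMinusX ^ᵖ m
    collect : ∀ s b₀ b₁ → + 1 * (- s * b₁) + -1ℤ * (s * b₀) ≡ - s * (b₀ + b₁)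
    collect = solve-∀

  ∑-convolve-δ-out : ∀ {i e} (f : ℕ → ℤ) → i < e → ∑[ j < suc i ] (f j * δ (i ∸ j) e) ≡ 0ℤ
  ∑-convolve-δ-out {i} f i<e = ∑-zero (suc i) (λ j _ →
    trans (cong (f j *_) (δ-≢ (ℕ.<⇒≢ (ℕ.≤-<-trans (ℕ.m∸n≤m i j) i<e)))) (*-zeroʳ (f j)))

  ∑-convolve-δ : ∀ {i e} (f : ℕ → ℤ) → e ≤ i → ∑[ j < suc i ] (f j * δ (i ∸ j) e) ≡ f (i ∸ e)
  ∑-convolve-δ {zero} {zero} f z≤n = trans (+-identityʳ _) (*-identityʳ (f 0))
  ∑-convolve-δ {suc i} {e} f e≤1+i with ℕ.m≤n⇒m<n∨m≡n e≤1+i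
  ... | inj₁ (s≤s e≤i) = begin
    f 0 * δ (suc i) e + ∑[ j < suc i ] (f (suc j) * δ (i ∸ j) e)
      ≡⟨ cong₂ _+_ (trans (cong (f 0 *_) (δ-≢ (ℕ.<⇒≢ (s≤s e≤i) ∘ sym))) (*-zeroʳ (f 0)))
                   (∑-convolve-δ (f ∘ suc) e≤i) ⟩
    0ℤ + f (suc (i ∸ e))
      ≡⟨ +-identityˡ _ ⟩
    f (suc (i ∸ e))
      ≡⟨ cong f (ℕ.+-∸-assoc 1 e≤i) ⟨
    f (suc i ∸ e) ∎
  ... | inj₂ refl = begin
    f 0 * δ (suc i) (suc i) + ∑[ j < suc i ] (f (suc j) * δ (i ∸ j) (suc i))
      ≡⟨ cong₂ _+_ (trans (cong (f 0 *_) (δ-refl (suc i))) (*-identityʳ (f 0)))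
                   (∑-convolve-δ-out {i} (f ∘ suc) ℕ.≤-refl) ⟩
    f 0 + 0ℤ
      ≡⟨ +-identityʳ _ ⟩
    f 0
      ≡⟨ cong f (ℕ.n∸n≡0 i) ⟨
    f (i ∸ i) ∎

  coeff-term : ∀ {d m k} → k ≤ d → m < d → coeff ((oneMinusX ^ᵖ m) ⊗ (X ^ᵖ (d ∸ m))) (d ∸ k) ≡ σ m k
  coeff-term {d} {m} {k} k≤d m<d = begin
    coeff ((oneMinusX ^ᵖ m) ⊗ (X ^ᵖ (d ∸ m))) (d ∸ k)
      ≡⟨ coeff-⊗ (oneMinusX ^ᵖ m) (X ^ᵖ (d ∸ m)) (d ∸ k) ⟩
    ∑[ j < suc (d ∸ k) ] (coeff (oneMinusX ^ᵖ m) j * coeff (X ^ᵖ (d ∸ m)) ((d ∸ k) ∸ j))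
      ≡⟨ ∑-cong′ (suc (d ∸ k)) (λ j → cong₂ _*_ (coeff-1-X^ m j) (coeff-X^ (d ∸ m) ((d ∸ k) ∸ j))) ⟩
    ∑[ j < suc (d ∸ k) ] (f j * δ ((d ∸ k) ∸ j) (d ∸ m))
      ≡⟨ by-cases ⟩
    σ m k ∎
    where
    f : ℕ → ℤ
    f j = sgn j * + binom m j
    ∸-∸-swap : (d ∸ k) ∸ (d ∸ m) ≡ m ∸ k
    ∸-∸-swap = begin
      (d ∸ k) ∸ (d ∸ m)      ≡⟨ ℕ.∸-+-assoc d k (d ∸ m) ⟩
      d ∸ (k ℕ.+ (d ∸ m))    ≡⟨ cong (d ∸_) (ℕ.+-comm k (d ∸ m)) ⟩
      d ∸ ((d ∸ m) ℕ.+ k)    ≡⟨ ℕ.∸-+-assoc d (d ∸ m) k ⟨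
      (d ∸ (d ∸ m)) ∸ k      ≡⟨ cong (_∸ k) (ℕ.m∸[m∸n]≡n (ℕ.<⇒≤ m<d)) ⟩
      m ∸ k                  ∎
    by-cases : ∑[ j < suc (d ∸ k) ] (f j * δ ((d ∸ k) ∸ j) (d ∸ m)) ≡ σ m k
    by-cases with ℕ.≤-<-connex k m
    ... | inj₁ k≤m = begin
      ∑[ j < suc (d ∸ k) ] (f j * δ ((d ∸ k) ∸ j) (d ∸ m))
        ≡⟨ ∑-convolve-δ f (ℕ.∸-monoʳ-≤ d k≤m) ⟩
      f ((d ∸ k) ∸ (d ∸ m))
        ≡⟨ cong f ∸-∸-swap ⟩
      sgn (m ∸ k) * + binom m (m ∸ k)
        ≡⟨ cong (λ z → sgn (m ∸ k) * + z) (binom-sym k≤m) ⟨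
      σ m k ∎
    ... | inj₂ m<k = trans (∑-convolve-δ-out f (ℕ.∸-monoʳ-< m<k k≤d))
      (sym (trans (cong (λ z → sgn (m ∸ k) * + z) (binom-vanish m<k)) (*-zeroʳ (sgn (m ∸ k)))))

  coeff-fd00 : ∀ {d k} → k ≤ d →
    coeff (fd00 d) (d ∸ k) ≡ ∑[ m < d ] (+ (catalan (d ∸ 1 ∸ m) ℕ.* ((d ∸ 1 ∸ m) C m)) * σ m k)
  coeff-fd00 {d} {k} k≤d = begin
    coeff (fd00 d) (d ∸ k)
      ≡⟨ coeff-polySum d (λ m → const (a m) ⊗ term m) (d ∸ k) ⟩
    ∑[ m < d ] coeff (const (a m) ⊗ term m) (d ∸ k)
      ≡⟨ ∑-cong d (λ m m<d → trans (coeff-const⊗ (a m) (term m) (d ∸ k)) (cong (a m *_) (coeff-term k≤d m<d))) ⟩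
    ∑[ m < d ] (a m * σ m k) ∎
    where
    a : ℕ → ℤ
    a m = + (catalan (d ∸ 1 ∸ m) ℕ.* ((d ∸ 1 ∸ m) C m))
    term : ℕ → Poly
    term m = (oneMinusX ^ᵖ m) ⊗ (X ^ᵖ (d ∸ m))

module Moments where

  open import Data.Nat as ℕ using (ℕ; zero; suc; _≤_; _<_; z≤n; s≤s; _∸_)
  import Data.Nat.Properties as ℕ
  open import Data.Nat.Tactic.RingSolver as ℕ-Solver using ()
  open import Data.Integer using (ℤ; +_; _+_; _*_; _-_; 0ℤ)
  open import Data.Integer.Properties
  open import Data.Integer.Tactic.RingSolver using (solve-∀)
  open import Relation.Binary.PropositionalEquality
  open import Relation.Nullary using (yes; no)
  open import Algebra.Bundles using (AbelianGroup)
  open import Algebra.Properties.Group (AbelianGroup.group +-0-abelianGroup) using (∙-cancelʳ)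
  open Binomials
  open Sums
  open ≡-Reasoning

  -- Families X j N R indexed by a number j of marks, a number N of
  -- vertices and a number R of trees.
  Family : Set
  Family = ℕ → ℕ → ℕ → ℤ

  -- The recurrence satisfied both by the binomial moments of the forest
  -- counts and by their closed form; together with the values at R = 0
  -- it determines a family (recurrence-unique).
  record Recurrence (X : Family) : Set where
    field
      vanish : ∀ j {N R} → N < R → X j N R ≡ 0ℤ
      step₁ : ∀ j R → X j 1 (suc R) ≡ X j 0 R + X j 1 (suc (suc R))
      step₂ : ∀ j M R → X j (suc (suc M)) (suc R)
                      ≡ X j (suc M) R + X j (suc (suc M)) (suc (suc R)) + shift (λ i → X i M R) j

  module _ {X Y : Family} (RX : Recurrence X) (RY : Recurrence Y)
           (initial : ∀ j N → X j N 0 ≡ Y j N 0) where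
    open Recurrence

    private
      -- one more tree means one step less to the boundary R = N + 1
      move-suc : ∀ R t {n} → suc R ℕ.+ suc t ≡ n → suc (suc R) ℕ.+ t ≡ n
      move-suc R t eq = trans (cong suc (sym (ℕ.+-suc R t))) eq

    -- Induction on N, and for fixed N on the distance t = N + 1 - R.
    recurrence-unique : ∀ N R j → X j N R ≡ Y j N R
    agree-at-distance : ∀ N t R j → R ℕ.+ t ≡ suc N → X j N R ≡ Y j N R

    recurrence-unique N R j with R ℕ.≤? suc N
    ... | yes R≤N+1 = agree-at-distance N (suc N ∸ R) R j (ℕ.m+[n∸m]≡n R≤N+1)
    ... | no R≰N+1 = trans (vanish RX j N<R) (sym (vanish RY j N<R))
      where N<R = ℕ.<-trans (ℕ.n<1+n N) (ℕ.≰⇒> R≰N+1)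

    agree-at-distance N zero R j R+0≡N+1 = trans (vanish RX j N<R) (sym (vanish RY j N<R))
      where N<R = ℕ.≤-reflexive (trans (sym R+0≡N+1) (ℕ.+-identityʳ R))
    agree-at-distance N (suc t) zero j _ = initial j N
    agree-at-distance zero (suc t) (suc R) j R+t+1≡1
      with () ← trans (sym (ℕ.+-suc R t)) (ℕ.suc-injective R+t+1≡1)
    agree-at-distance 1 (suc t) (suc R) j R+t+1≡2 = begin
      X j 1 (suc R)                          ≡⟨ step₁ RX j R ⟩
      X j 0 R + X j 1 (suc (suc R))          ≡⟨ cong₂ _+_ (recurrence-unique 0 R j)
                                                          (agree-at-distance 1 t (suc (suc R)) j (move-suc R t R+t+1≡2)) ⟩
      Y j 0 R + Y j 1 (suc (suc R))          ≡⟨ step₁ RY j R ⟨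
      Y j 1 (suc R)                          ∎
    agree-at-distance (suc (suc M)) (suc t) (suc R) j R+t+1≡M+3 = begin
      X j (suc (suc M)) (suc R)
        ≡⟨ step₂ RX j M R ⟩
      X j (suc M) R + X j (suc (suc M)) (suc (suc R)) + shift (λ i → X i M R) j
        ≡⟨ cong₂ _+_ (cong₂ _+_ (recurrence-unique (suc M) R j)
                                (agree-at-distance (suc (suc M)) t (suc (suc R)) j (move-suc R t R+t+1≡M+3)))
                     (shifted j) ⟩
      Y j (suc M) R + Y j (suc (suc M)) (suc (suc R)) + shift (λ i → Y i M R) j
        ≡⟨ step₂ RY j M R ⟨
      Y j (suc (suc M)) (suc R) ∎
      where
      shifted : ∀ j → shift (λ i → X i M R) j ≡ shift (λ i → Y i M R) j
      shifted zero = refl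
      shifted (suc j) = recurrence-unique M R j

  -- The closed form: F(N-j, R) C(N-j, j) forests with N vertices, R trees
  -- and j marked special vertices (unmark and delete the j marked leaves).
  marked : ℕ → ℕ → ℕ → ℕ
  marked j N R = forestNum (N ∸ j) R ℕ.* binom (N ∸ j) j

  -- The closed form obeys step₂: for j = 0 this is forestNum-step, for j ≥ 1
  -- forestNum-step combined with Pascal's rule; with more marks than
  -- vertices every term vanishes.
  marked-step₂ : ∀ j M R → marked j (suc (suc M)) (suc R)
    ≡ marked j (suc M) R ℕ.+ marked j (suc (suc M)) (suc (suc R)) ℕ.+ shiftℕ (λ i → marked i M R) j
  marked-step₂ zero M R = begin
    forestNum (suc (suc M)) (suc R) ℕ.* 1
      ≡⟨ ℕ.*-identityʳ _ ⟩
    forestNum (suc (suc M)) (suc R)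
      ≡⟨ forestNum-step (suc M) R ⟩
    forestNum (suc M) R ℕ.+ forestNum (suc (suc M)) (suc (suc R))
      ≡⟨ cong₂ ℕ._+_ (ℕ.*-identityʳ (forestNum (suc M) R)) (ℕ.*-identityʳ (forestNum (suc (suc M)) (suc (suc R)))) ⟨
    forestNum (suc M) R ℕ.* 1 ℕ.+ forestNum (suc (suc M)) (suc (suc R)) ℕ.* 1
      ≡⟨ ℕ.+-identityʳ _ ⟨
    marked 0 (suc M) R ℕ.+ marked 0 (suc (suc M)) (suc (suc R)) ℕ.+ 0 ∎
  marked-step₂ (suc j) M R with j ℕ.≤? M
  ... | yes j≤M rewrite ℕ.+-∸-assoc 1 j≤M = begin
    forestNum (suc L) (suc R) ℕ.* binom (suc L) (suc j)
      ≡⟨ cong (ℕ._* binom (suc L) (suc j)) (forestNum-step L R) ⟩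
    (forestNum L R ℕ.+ forestNum (suc L) (suc (suc R))) ℕ.* (binom L j ℕ.+ binom L (suc j))
      ≡⟨ expand (forestNum L R) (forestNum (suc L) (suc (suc R))) (binom L j) (binom L (suc j)) ⟩
    forestNum L R ℕ.* binom L (suc j) ℕ.+ forestNum (suc L) (suc (suc R)) ℕ.* binom (suc L) (suc j)
      ℕ.+ forestNum L R ℕ.* binom L j ∎
    where
    L = M ∸ j
    expand : ∀ F₁ F₂ b₀ b₁ → (F₁ ℕ.+ F₂) ℕ.* (b₀ ℕ.+ b₁) ≡ F₁ ℕ.* b₁ ℕ.+ F₂ ℕ.* (b₀ ℕ.+ b₁) ℕ.+ F₁ ℕ.* b₀
    expand = ℕ-Solver.solve-∀
  ... | no j≰M rewrite ℕ.m≤n⇒m∸n≡0 (ℕ.≰⇒> j≰M) | ℕ.m≤n⇒m∸n≡0 (ℕ.<⇒≤ (ℕ.≰⇒> j≰M)) = sym (begin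
    forestNum 0 R ℕ.* 0 ℕ.+ 0 ℕ.+ forestNum 0 R ℕ.* binom 0 j
      ≡⟨ cong₂ (λ u v → u ℕ.+ 0 ℕ.+ forestNum 0 R ℕ.* v) (ℕ.*-zeroʳ (forestNum 0 R)) (binom-vanish 0<j) ⟩
    forestNum 0 R ℕ.* 0
      ≡⟨ ℕ.*-zeroʳ (forestNum 0 R) ⟩
    0 ∎)
    where 0<j = ℕ.≤-trans (s≤s z≤n) (ℕ.≰⇒> j≰M)

  markedℤ : Family
  markedℤ j N R = + marked j N R

  markedℤ-recurrence : Recurrence markedℤ
  markedℤ-recurrence = record { vanish = vanish ; step₁ = step₁ ; step₂ = step₂ }
    where
    vanish : ∀ j {N R} → N < R → markedℤ j N R ≡ 0ℤ
    vanish j {N} {R} N<R = cong (λ z → + (z ℕ.* binom (N ∸ j) j))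
      (forestNum-vanish (ℕ.≤-<-trans (ℕ.m∸n≤m N j) N<R))
    step₁ : ∀ j R → markedℤ j 1 (suc R) ≡ markedℤ j 0 R + markedℤ j 1 (suc (suc R))
    step₁ zero R = begin
      + (forestNum 1 (suc R) ℕ.* 1)
        ≡⟨ cong +_ (ℕ.*-identityʳ _) ⟩
      + forestNum 1 (suc R)
        ≡⟨ cong +_ (forestNum-step 0 R) ⟩
      + (forestNum 0 R ℕ.+ forestNum 1 (suc (suc R)))
        ≡⟨ cong +_ (cong₂ ℕ._+_ (ℕ.*-identityʳ (forestNum 0 R)) (ℕ.*-identityʳ (forestNum 1 (suc (suc R))))) ⟨
      + (marked 0 0 R ℕ.+ marked 0 1 (suc (suc R)))
        ≡⟨ pos-+ (marked 0 0 R) _ ⟩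
      markedℤ 0 0 R + markedℤ 0 1 (suc (suc R)) ∎
    -- with a mark, a single vertex admits no forest: both sides vanish
    step₁ (suc j) R rewrite ℕ.0∸n≡0 j = sym (trans (sym (pos-+ (forestNum 0 R ℕ.* 0) _))
                                 (cong +_ (trans (ℕ.+-identityʳ _) (ℕ.*-zeroʳ (forestNum 0 R)))))
    step₂ : ∀ j M R → markedℤ j (suc (suc M)) (suc R)
      ≡ markedℤ j (suc M) R + markedℤ j (suc (suc M)) (suc (suc R)) + shift (λ i → markedℤ i M R) j
    step₂ j M R = begin
      + marked j (suc (suc M)) (suc R)
        ≡⟨ cong +_ (marked-step₂ j M R) ⟩
      + (marked j (suc M) R ℕ.+ marked j (suc (suc M)) (suc (suc R)) ℕ.+ shiftℕ (λ i → marked i M R) j)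
        ≡⟨ pos-+ _ (shiftℕ (λ i → marked i M R) j) ⟩
      + (marked j (suc M) R ℕ.+ marked j (suc (suc M)) (suc (suc R))) + + shiftℕ (λ i → marked i M R) j
        ≡⟨ cong₂ _+_ (pos-+ (marked j (suc M) R) _) (pos-shift j) ⟩
      markedℤ j (suc M) R + markedℤ j (suc (suc M)) (suc (suc R)) + shift (λ i → markedℤ i M R) j ∎
      where pos-shift : ∀ j → + shiftℕ (λ i → marked i M R) j ≡ shift (λ i → markedℤ i M R) j
            pos-shift zero = refl
            pos-shift (suc j) = refl

  -- Summing forestNum-step over R telescopes: the forests with A vertices
  -- number ballot A 0 = F(A+1, 1) in total.
  forestNum-telescope : ∀ A T → + forestNum (suc A) 1 ≡ ∑[ R < T ] (+ forestNum A R) + + forestNum (suc A) (suc T)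
  forestNum-telescope A zero = sym (+-identityˡ _)
  forestNum-telescope A (suc T) = begin
    + forestNum (suc A) 1
      ≡⟨ forestNum-telescope A T ⟩
    ∑[ R < T ] (+ forestNum A R) + + forestNum (suc A) (suc T)
      ≡⟨ cong (_+_ (∑[ R < T ] (+ forestNum A R))) (trans (cong +_ (forestNum-step A T)) (pos-+ (forestNum A T) _)) ⟩
    ∑[ R < T ] (+ forestNum A R) + (+ forestNum A T + + forestNum (suc A) (suc (suc T)))
      ≡⟨ +-assoc (∑[ R < T ] (+ forestNum A R)) (+ forestNum A T) _ ⟨
    ∑[ R < T ] (+ forestNum A R) + + forestNum A T + + forestNum (suc A) (suc (suc T))
      ≡⟨ cong (_+ + forestNum (suc A) (suc (suc T))) (∑-snoc T (λ R → + forestNum A R)) ⟨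
    ∑[ R < suc T ] (+ forestNum A R) + + forestNum (suc A) (suc (suc T)) ∎

  forestNum-total : ∀ {A B} → A < B → ∑[ R < B ] (+ forestNum A R) ≡ + ballot A 0
  forestNum-total {A} {B} A<B = begin
    ∑[ R < B ] (+ forestNum A R)
      ≡⟨ ∑-truncate A<B (λ R A<R → cong +_ (forestNum-vanish A<R)) ⟩
    ∑[ R < suc A ] (+ forestNum A R)
      ≡⟨ +-identityʳ _ ⟨
    ∑[ R < suc A ] (+ forestNum A R) + 0ℤ
      ≡⟨ cong (_+_ (∑[ R < suc A ] (+ forestNum A R))) (cong +_ (forestNum-vanish (ℕ.n<1+n (suc A)))) ⟨
    ∑[ R < suc A ] (+ forestNum A R) + + forestNum (suc A) (suc (suc A))
      ≡⟨ forestNum-telescope A (suc A) ⟨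
    + ballot A 0 ∎

  -- Any forest count satisfying the combinatorial recurrences below has
  -- binomial moments markedℤ (moment≡marked); summing over the number of
  -- trees and inverting the binomial transform expresses the number of
  -- forests with n vertices and k special vertices through Catalan numbers.
  module ForestMoments
    (count : ℕ → ℕ → ℕ → ℕ)
    (count-empty : count 0 0 0 ≡ 1)
    (count-no-trees : ∀ N K → count (suc N) 0 K ≡ 0)
    (count-few-vertices : ∀ {N R} K → N < R → count N R K ≡ 0)
    (count-few-specials : ∀ {N K} R → N < K → count N R K ≡ 0)
    (count-step₁ : ∀ R K → count 1 (suc R) K ≡ count 0 R K ℕ.+ count 1 (suc (suc R)) K)
    (count-step₂ : ∀ M R K → count (suc (suc M)) (suc R) K ℕ.+ count M R K
                           ≡ count (suc M) R K ℕ.+ count (suc (suc M)) (suc (suc R)) K ℕ.+ shiftℕ (count M R) K)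
    where

    moment : Family
    moment j N R = ∑[ K < suc N ] (+ binom K j * + count N R K)

    moment-extend : ∀ {B} j N R → suc N ≤ B → ∑[ K < B ] (+ binom K j * + count N R K) ≡ moment j N R
    moment-extend j N R N<B = ∑-truncate N<B (λ K N<K →
      trans (cong (λ z → + binom K j * + z) (count-few-specials R N<K)) (*-zeroʳ (+ binom K j)))

    ∑-split : ∀ B j {f g h : ℕ → ℕ} → (∀ K → f K ≡ g K ℕ.+ h K) →
      ∑[ K < B ] (+ binom K j * + f K) ≡ ∑[ K < B ] (+ binom K j * + g K) + ∑[ K < B ] (+ binom K j * + h K)
    ∑-split B j {f} {g} {h} f≡g+h = trans
      (∑-cong′ B (λ K → trans (cong (λ z → + binom K j * z) (trans (cong +_ (f≡g+h K)) (pos-+ (g K) (h K))))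
                              (*-distribˡ-+ (+ binom K j) (+ g K) (+ h K))))
      (∑-+ B (λ K → + binom K j * + g K) (λ K → + binom K j * + h K))

    -- shifting the special count shifts the moments (Pascal's rule)
    moment-shift : ∀ j M R → ∑[ K < suc (suc (suc M)) ] (+ binom K j * + shiftℕ (count M R) K)
                           ≡ shift (λ i → moment i M R) j + moment j M R
    moment-shift j M R = begin
      + binom 0 j * 0ℤ + ∑[ K < suc (suc M) ] (+ binom (suc K) j * + count M R K)
        ≡⟨ cong (_+ ∑[ K < suc (suc M) ] (+ binom (suc K) j * + count M R K)) (*-zeroʳ (+ binom 0 j)) ⟩
      0ℤ + (∑[ K < suc (suc M) ] (+ binom (suc K) j * + count M R K))
        ≡⟨ +-identityˡ _ ⟩
      ∑[ K < suc (suc M) ] (+ binom (suc K) j * + count M R K)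
        ≡⟨ ∑-cong′ (suc (suc M)) (λ K → trans (cong (λ z → + z * + count M R K) (pascal K j))
              (trans (cong (_* + count M R K) (pos-+ (binom₋ K j) (binom K j)))
                     (*-distribʳ-+ (+ count M R K) (+ binom₋ K j) (+ binom K j)))) ⟩
      ∑[ K < suc (suc M) ] (+ binom₋ K j * + count M R K + + binom K j * + count M R K)
        ≡⟨ ∑-+ (suc (suc M)) (λ K → + binom₋ K j * + count M R K) (λ K → + binom K j * + count M R K) ⟩
      ∑[ K < suc (suc M) ] (+ binom₋ K j * + count M R K) + ∑[ K < suc (suc M) ] (+ binom K j * + count M R K)
        ≡⟨ cong₂ _+_ (lowered j) (moment-extend j M R (ℕ.n≤1+n _)) ⟩
      shift (λ i → moment i M R) j + moment j M R ∎
      where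
      lowered : ∀ j → ∑[ K < suc (suc M) ] (+ binom₋ K j * + count M R K) ≡ shift (λ i → moment i M R) j
      lowered zero = ∑-zero (suc (suc M)) (λ _ _ → refl)
      lowered (suc j) = moment-extend j M R (ℕ.n≤1+n _)

    moment-recurrence : Recurrence moment
    moment-recurrence = record { vanish = vanish ; step₁ = step₁ ; step₂ = step₂ }
      where
      vanish : ∀ j {N R} → N < R → moment j N R ≡ 0ℤ
      vanish j {N} {R} N<R = ∑-zero (suc N) (λ K _ →
        trans (cong (λ z → + binom K j * + z) (count-few-vertices K N<R)) (*-zeroʳ (+ binom K j)))
      step₁ : ∀ j R → moment j 1 (suc R) ≡ moment j 0 R + moment j 1 (suc (suc R))
      step₁ j R = trans (∑-split 2 j {g = count 0 R} {h = count 1 (suc (suc R))} (count-step₁ R))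
        (cong (_+ moment j 1 (suc (suc R))) (moment-extend {2} j 0 R (s≤s z≤n)))
      step₂ : ∀ j M R → moment j (suc (suc M)) (suc R)
                      ≡ moment j (suc M) R + moment j (suc (suc M)) (suc (suc R)) + shift (λ i → moment i M R) j
      step₂ j M R = ∙-cancelʳ (moment j M R) _ _ (begin
        moment j (suc (suc M)) (suc R) + moment j M R
          ≡⟨ cong (_+ moment j M R) (moment-extend j (suc (suc M)) (suc R) ℕ.≤-refl) ⟨
        ∑[ K < B ] (+ binom K j * + count (suc (suc M)) (suc R) K) + moment j M R
          ≡⟨ cong (_+_ (∑[ K < B ] (+ binom K j * + count (suc (suc M)) (suc R) K))) (moment-extend j M R (ℕ.m≤n+m (suc M) 2)) ⟨
        ∑[ K < B ] (+ binom K j * + count (suc (suc M)) (suc R) K) + ∑[ K < B ] (+ binom K j * + count M R K)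
          ≡⟨ ∑-split B j {g = count (suc (suc M)) (suc R)} {h = count M R} (λ K → refl) ⟨
        ∑[ K < B ] (+ binom K j * + (count (suc (suc M)) (suc R) K ℕ.+ count M R K))
          ≡⟨ ∑-cong′ B (λ K → cong (λ z → + binom K j * + z) (count-step₂ M R K)) ⟩
        ∑[ K < B ] (+ binom K j * + (count (suc M) R K ℕ.+ count (suc (suc M)) (suc (suc R)) K ℕ.+ shiftℕ (count M R) K))
          ≡⟨ ∑-split B j {g = λ K → count (suc M) R K ℕ.+ count (suc (suc M)) (suc (suc R)) K} {h = shiftℕ (count M R)} (λ K → refl) ⟩
        ∑[ K < B ] (+ binom K j * + (count (suc M) R K ℕ.+ count (suc (suc M)) (suc (suc R)) K))
          + ∑[ K < B ] (+ binom K j * + shiftℕ (count M R) K)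
          ≡⟨ cong₂ _+_ (trans (∑-split B j {g = count (suc M) R} {h = count (suc (suc M)) (suc (suc R))} (λ K → refl))
                              (cong₂ _+_ (moment-extend j (suc M) R (ℕ.n≤1+n _)) (moment-extend j (suc (suc M)) (suc (suc R)) ℕ.≤-refl)))
                       (moment-shift j M R) ⟩
        moment j (suc M) R + moment j (suc (suc M)) (suc (suc R)) + (shift (λ i → moment i M R) j + moment j M R)
          ≡⟨ +-assoc (moment j (suc M) R + moment j (suc (suc M)) (suc (suc R))) _ _ ⟨
        moment j (suc M) R + moment j (suc (suc M)) (suc (suc R)) + shift (λ i → moment i M R) j + moment j M R ∎)
        where B = suc (suc (suc M))

    -- without trees only the empty forest remains
    moment-initial : ∀ j N → moment j N 0 ≡ markedℤ j N 0
    moment-initial j zero = begin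
      + binom 0 j * + count 0 0 0 + 0ℤ  ≡⟨ +-identityʳ _ ⟩
      + binom 0 j * + count 0 0 0       ≡⟨ cong (λ z → + binom 0 j * + z) count-empty ⟩
      + binom 0 j * + 1                 ≡⟨ *-identityʳ (+ binom 0 j) ⟩
      + binom 0 j                       ≡⟨ cong +_ (ℕ.*-identityˡ (binom 0 j)) ⟨
      + (1 ℕ.* binom 0 j)               ≡⟨ cong (λ z → + (forestNum z 0 ℕ.* binom z j)) (ℕ.0∸n≡0 j) ⟨
      markedℤ j 0 0                     ∎
    moment-initial j (suc N) = trans
      (∑-zero (suc (suc N)) (λ K _ → trans (cong (λ z → + binom K j * + z) (count-no-trees N K)) (*-zeroʳ (+ binom K j))))
      (sym (cong +_ (no-trees j)))
      where
      no-trees : ∀ j → marked j (suc N) 0 ≡ 0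
      no-trees j with j ℕ.≤? N
      ... | yes j≤N rewrite ℕ.+-∸-assoc 1 j≤N = refl
      ... | no j≰N rewrite ℕ.m≤n⇒m∸n≡0 (ℕ.≰⇒> j≰N) = trans (ℕ.+-identityʳ (binom 0 j)) (binom-vanish (ℕ.≤-<-trans z≤n (ℕ.≰⇒> j≰N)))

    moment≡marked : ∀ j N R → moment j N R ≡ markedℤ j N R
    moment≡marked j N R = recurrence-unique moment-recurrence markedℤ-recurrence moment-initial N R j

    total : ℕ → ℕ → ℤ
    total n K = ∑[ R < suc n ] (+ count n R K)

    total-vanish : ∀ {n K} → n < K → total n K ≡ 0ℤ
    total-vanish {n} n<K = ∑-zero (suc n) (λ R _ → cong +_ (count-few-specials R n<K))

    total-moment : ∀ n j → ∑[ K < suc n ] (+ binom K j * total n K) ≡ + (ballot (n ∸ j) 0 ℕ.* binom (n ∸ j) j)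
    total-moment n j = begin
      ∑[ K < suc n ] (+ binom K j * total n K)
        ≡⟨ ∑-cong′ (suc n) (λ K → ∑-*ˡ (suc n) (+ binom K j) (λ R → + count n R K)) ⟩
      ∑[ K < suc n ] ∑[ R < suc n ] (+ binom K j * + count n R K)
        ≡⟨ ∑-swap (suc n) (suc n) (λ K R → + binom K j * + count n R K) ⟩
      ∑[ R < suc n ] moment j n R
        ≡⟨ ∑-cong′ (suc n) (λ R → trans (moment≡marked j n R) (pos-* (forestNum (n ∸ j) R) (binom (n ∸ j) j))) ⟩
      ∑[ R < suc n ] (+ forestNum (n ∸ j) R * + binom (n ∸ j) j)
        ≡⟨ ∑-*ʳ (suc n) (λ R → + forestNum (n ∸ j) R) (+ binom (n ∸ j) j) ⟨
      ∑[ R < suc n ] (+ forestNum (n ∸ j) R) * + binom (n ∸ j) j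
        ≡⟨ cong (_* + binom (n ∸ j) j) (forestNum-total (s≤s (ℕ.m∸n≤m n j))) ⟩
      + ballot (n ∸ j) 0 * + binom (n ∸ j) j
        ≡⟨ pos-* (ballot (n ∸ j) 0) (binom (n ∸ j) j) ⟨
      + (ballot (n ∸ j) 0 ℕ.* binom (n ∸ j) j) ∎

    total-inverted : ∀ n k → ∑[ m < suc n ] (+ (ballot (n ∸ m) 0 ℕ.* binom (n ∸ m) m) * σ m k) ≡ total n k
    total-inverted n k = begin
      ∑[ m < suc n ] (+ (ballot (n ∸ m) 0 ℕ.* binom (n ∸ m) m) * σ m k)
        ≡⟨ ∑-cong′ (suc n) (λ m → cong (_* σ m k) (total-moment n m)) ⟨
      ∑[ m < suc n ] (∑[ K < suc n ] (+ binom K m * total n K) * σ m k)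
        ≡⟨ invert-binomial-transform (suc n) (total n) (λ _ → total-vanish) k ⟩
      total n k ∎

module Finiteness where

  open import Data.Nat using (ℕ; zero; suc; _+_)
  open import Data.Fin using (Fin; zero; suc; toℕ)
  open import Data.List using (List; _∷_; length; lookup; filter; deduplicate)
  open import Data.List.Membership.Propositional using (_∈_)
  open import Data.List.Membership.Propositional.Properties using (∈-lookup; ∈-filter⁺; ∈-filter⁻; ∈-deduplicate⁺)
  open import Data.List.Membership.Propositional.Properties.WithK using (unique⇒irrelevant)
  open import Data.List.Relation.Unary.Any using (index)
  open import Data.List.Relation.Unary.Any.Properties using (lookup-index)
  open import Data.List.Relation.Unary.Unique.Propositional using (Unique)
  open import Data.List.Relation.Unary.Unique.Propositional.Properties using (filter⁺)
  open import Data.List.Relation.Unary.Unique.DecPropositional.Properties using (deduplicate-!)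
  open import Data.Product using (Σ; _,_; proj₂)
  open import Data.Sum using (_⊎_; inj₁; inj₂)
  open import Data.Sum.Function.Propositional using (_⊎-cong_)
  open import Data.Fin.Properties using (+↔⊎)
  open import Data.Fin.Permutation using (↔⇒≡)
  open import Function.Bundles using (_↔_; mk↔ₛ′; Inverse)
  open import Function.Properties.Inverse using (↔-trans; ↔-sym)
  open import Relation.Nullary using (¬_; contradiction)
  open import Relation.Binary.Definitions using (DecidableEquality)
  open import Relation.Binary.PropositionalEquality
  open import Function using (id; _∘_)
  open import Relation.Unary using (Decidable; Irrelevant)

  record Finite (A : Set) : Set where
    field
      card : ℕ
      enum : Fin card ↔ A

  Σ-≡-irrelevant : ∀ {A : Set} {P : A → Set} → Irrelevant P →
    ∀ {x y} {p : P x} {q : P y} → x ≡ y → _≡_ {A = Σ A P} (x , p) (y , q)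
  Σ-≡-irrelevant P-irr {x} {p = p} {q} refl = cong (x ,_) (P-irr p q)

  index-∈-lookup : ∀ {A : Set} (xs : List A) (i : Fin (length xs)) → index (∈-lookup {xs = xs} i) ≡ i
  index-∈-lookup (x ∷ xs) zero = refl
  index-∈-lookup (x ∷ xs) (suc i) = cong suc (index-∈-lookup xs i)

  unique-enum : ∀ {A : Set} {xs : List A} → Unique xs → Fin (length xs) ↔ Σ A (_∈ xs)
  unique-enum {xs = xs} xs-unique = mk↔ₛ′
    (λ i → lookup xs i , ∈-lookup i) (λ (x , x∈xs) → index x∈xs)
    (λ (x , x∈xs) → Σ-≡-irrelevant (unique⇒irrelevant xs-unique) (sym (lookup-index x∈xs)))
    (index-∈-lookup xs)

  restrict-↔ : ∀ {X Y : Set} {P : X → Set} {Q : Y → Set} (f : X → Y) (g : Y → X) →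
    (∀ {x} → P x → Q (f x)) → (∀ {y} → Q y → P (g y)) →
    (∀ {x} → P x → g (f x) ≡ x) → (∀ {y} → Q y → f (g y) ≡ y) →
    Irrelevant P → Irrelevant Q → Σ X P ↔ Σ Y Q
  restrict-↔ f g f-pres g-pres gf fg P-irr Q-irr = mk↔ₛ′
    (λ (x , p) → f x , f-pres p) (λ (y , q) → g y , g-pres q)
    (λ (y , q) → Σ-≡-irrelevant Q-irr (fg q)) (λ (x , p) → Σ-≡-irrelevant P-irr (gf p))

  enum-unique : ∀ {A : Set} {a b} → Fin a ↔ A → Fin b ↔ A → a ≡ b
  enum-unique e₁ e₂ = ↔⇒≡ (↔-trans e₁ (↔-sym e₂))

  enum-empty : ∀ {A : Set} {a} → Fin a ↔ A → ¬ A → a ≡ 0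
  enum-empty {a = zero} _ _ = refl
  enum-empty {a = suc a} e ¬A = contradiction (Inverse.to e zero) ¬A

  enum-⊎ : ∀ {A B : Set} {a b} → Fin a ↔ A → Fin b ↔ B → Fin (a + b) ↔ (A ⊎ B)
  enum-⊎ e₁ e₂ = ↔-trans +↔⊎ (e₁ ⊎-cong e₂)

  ∑ℕ : ℕ → (ℕ → ℕ) → ℕ
  ∑ℕ zero g = 0
  ∑ℕ (suc n) g = g 0 + ∑ℕ n (g ∘ suc)

  enum-∑ : ∀ n (g : ℕ → ℕ) (B : ℕ → Set) → (∀ i → Fin (g i) ↔ B i) → Fin (∑ℕ n g) ↔ Σ (Fin n) (B ∘ toℕ)
  enum-∑ zero g B enum = mk↔ₛ′ (λ ()) (λ ()) (λ ()) (λ ())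
  enum-∑ (suc n) g B enum = ↔-trans (enum-⊎ (enum 0) (enum-∑ n (g ∘ suc) (B ∘ suc) (enum ∘ suc)))
    (mk↔ₛ′ (λ { (inj₁ b) → Fin.zero , b ; (inj₂ (i , b)) → Fin.suc i , b })
           (λ { (Fin.zero , b) → inj₁ b ; (Fin.suc i , b) → inj₂ (i , b) })
           (λ { (Fin.zero , b) → refl ; (Fin.suc i , b) → refl })
           (λ { (inj₁ b) → refl ; (inj₂ (i , b)) → refl }))

  finite-subset : ∀ {A : Set} → DecidableEquality A → {P : A → Set} → Decidable P → Irrelevant P →
    (xs : List A) → (∀ {x} → P x → x ∈ xs) → Finite (Σ A P)
  finite-subset _≟_ {P} P? P-irr xs complete = record
    { card = length members
    ; enum = ↔-trans (unique-enum members-unique)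
                     (restrict-↔ id id
                        (λ x∈ → proj₂ (∈-filter⁻ P? {xs = deduplicate _≟_ xs} x∈))
                        (λ Px → ∈-filter⁺ P? (∈-deduplicate⁺ _≟_ (complete Px)) Px)
                        (λ _ → refl) (λ _ → refl) (unique⇒irrelevant members-unique) P-irr)
    }
    where
    members = filter P? (deduplicate _≟_ xs)
    members-unique : Unique members
    members-unique = filter⁺ P? {deduplicate _≟_ xs} (deduplicate-! _≟_ xs)

module Forests where

  open import Data.Nat as ℕ using (ℕ; zero; suc; _+_; _≤_; _<_; z≤n; s≤s)
  import Data.Nat.Properties as ℕ
  open import Data.List using (List; []; _∷_; length; cartesianProductWith; _++_; _∷ʳ_)
  open import Data.List.Properties using (∷-injective)
  open import Data.List.Membership.Propositional using (_∈_)
  open import Data.List.Membership.Propositional.Properties using (∈-cartesianProductWith⁺)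
  open import Data.List.Relation.Unary.Any using (here; there)
  open import Data.Fin as Fin using (Fin)
  open import Data.Product using (Σ; _×_; _,_; proj₁; proj₂)
  open import Data.Sum using (_⊎_; inj₁; inj₂)
  open import Function.Bundles using (_↔_; mk↔ₛ′)
  open import Function.Properties.Inverse using (↔-trans; ↔-sym; ↔-refl)
  open import Function.Related.TypeIsomorphisms using (Σ-distribʳ-⊎)
  open import Data.Sum.Function.Propositional using (_⊎-cong_)
  open import Relation.Binary.Definitions using (DecidableEquality)
  open import Relation.Binary.PropositionalEquality
  open import Function using (_∘_; id)
  open import Relation.Nullary using (yes; no; map′; _×-dec_)
  open import Relation.Unary using (Decidable; Irrelevant)
  open Binomials using (shiftℕ)
  open Finiteness

  Forest : Set
  Forest = List PlaneTree

  _≟ᵗ_ : DecidableEquality PlaneTree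
  _≟ᶠ_ : DecidableEquality Forest
  node cs ≟ᵗ node ds = map′ (cong node) (λ { refl → refl }) (cs ≟ᶠ ds)
  [] ≟ᶠ [] = yes refl
  [] ≟ᶠ (_ ∷ _) = no λ ()
  (_ ∷ _) ≟ᶠ [] = no λ ()
  (t ∷ ts) ≟ᶠ (u ∷ us) = map′ (λ (t≡u , ts≡us) → cong₂ _∷_ t≡u ts≡us) ∷-injective ((t ≟ᵗ u) ×-dec (ts ≟ᶠ us))

  -- every forest with at most n vertices, with repetitions
  forestsUpTo : ℕ → List Forest
  forestsUpTo zero = [] ∷ []
  forestsUpTo (suc n) = [] ∷ cartesianProductWith (λ cs rest → node cs ∷ rest) (forestsUpTo n) (forestsUpTo n)

  forestsUpTo-complete : ∀ n f → sizes f ≤ n → f ∈ forestsUpTo n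
  forestsUpTo-complete zero [] _ = here refl
  forestsUpTo-complete (suc n) [] _ = here refl
  forestsUpTo-complete zero (node _ ∷ _) ()
  forestsUpTo-complete (suc n) (node cs ∷ rest) (s≤s size≤n) = there (∈-cartesianProductWith⁺ (λ cs rest → node cs ∷ rest)
    (forestsUpTo-complete n cs (ℕ.≤-trans (ℕ.m≤m+n (sizes cs) (sizes rest)) size≤n))
    (forestsUpTo-complete n rest (ℕ.≤-trans (ℕ.m≤n+m (sizes rest) (sizes cs)) size≤n)))

  -- A forest has N vertices, R trees and K special vertices.  (Its trees
  -- hang from a common parent, so the leftmost leaf children of all of
  -- its vertices are special.)
  record Shaped (N R K : ℕ) (f : Forest) : Set where
    constructor shaped
    field
      vertices : sizes f ≡ N
      trees : length f ≡ R
      specials : specialBelows f ≡ K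

  shaped? : ∀ N R K → Decidable (Shaped N R K)
  shaped? N R K f = map′ (λ (s , l , k) → shaped s l k) (λ (shaped s l k) → s , l , k)
    ((sizes f ℕ.≟ N) ×-dec (length f ℕ.≟ R) ×-dec (specialBelows f ℕ.≟ K))

  shaped-irrelevant : ∀ {N R K} → Irrelevant (Shaped N R K)
  shaped-irrelevant (shaped s l k) (shaped s′ l′ k′) =
    cong₃ shaped (ℕ.≡-irrelevant s s′) (ℕ.≡-irrelevant l l′) (ℕ.≡-irrelevant k k′)
    where cong₃ : ∀ {A B C D : Set} (f : A → B → C → D) {a a′ b b′ c c′} → a ≡ a′ → b ≡ b′ → c ≡ c′ → f a b c ≡ f a′ b′ c′
          cong₃ f refl refl refl = refl

  forests : ∀ N R K → Finite (Σ Forest (Shaped N R K))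
  forests N R K = finite-subset _≟ᶠ_ (shaped? N R K) shaped-irrelevant (forestsUpTo N)
    (λ {f} f-shaped → forestsUpTo-complete N f (ℕ.≤-reflexive (Shaped.vertices f-shaped)))

  count : ℕ → ℕ → ℕ → ℕ
  count N R K = Finite.card (forests N R K)

  count-enum : ∀ N R K → Fin (count N R K) ↔ Σ Forest (Shaped N R K)
  count-enum N R K = Finite.enum (forests N R K)

  length≤sizes : ∀ f → length f ≤ sizes f
  length≤sizes [] = z≤n
  length≤sizes (node cs ∷ f) = ℕ.+-mono-≤ (s≤s z≤n) (length≤sizes f)

  leftmostLeaf≤1 : ∀ cs → leftmostLeaf cs ≤ 1
  leftmostLeaf≤1 [] = z≤n
  leftmostLeaf≤1 (node [] ∷ _) = s≤s z≤n
  leftmostLeaf≤1 (node (_ ∷ _) ∷ _) = z≤n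

  specialBelow≤size : ∀ t → specialBelow t ≤ size t
  specialBelows≤sizes : ∀ f → specialBelows f ≤ sizes f
  specialBelow≤size (node cs) = ℕ.+-mono-≤ (leftmostLeaf≤1 cs) (specialBelows≤sizes cs)
  specialBelows≤sizes [] = z≤n
  specialBelows≤sizes (t ∷ f) = ℕ.+-mono-≤ (specialBelow≤size t) (specialBelows≤sizes f)

  count-few-vertices : ∀ {N R} K → N < R → count N R K ≡ 0
  count-few-vertices {N} {R} K N<R = enum-empty (count-enum N R K)
    λ (f , shaped size≡ length≡ _) → ℕ.<⇒≱ N<R (subst₂ _≤_ length≡ size≡ (length≤sizes f))

  count-few-specials : ∀ {N K} R → N < K → count N R K ≡ 0
  count-few-specials {N} {K} R N<K = enum-empty (count-enum N R K)
    λ (f , shaped size≡ _ specials≡) → ℕ.<⇒≱ N<K (subst₂ _≤_ specials≡ size≡ (specialBelows≤sizes f))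

  count-no-trees : ∀ N K → count (suc N) 0 K ≡ 0
  count-no-trees N K = enum-empty (count-enum (suc N) 0 K) λ { ([] , shaped () _ _) }

  count-empty : count 0 0 0 ≡ 1
  count-empty = enum-unique (count-enum 0 0 0) (mk↔ₛ′ (λ _ → [] , shaped refl refl refl) (λ _ → Fin.zero)
    (λ { ([] , shaped refl refl refl) → refl }) (λ { Fin.zero → refl ; (Fin.suc ()) }))

  -- with a single vertex left over, the first tree is a leaf
  count-step₁ : ∀ R K → count 1 (suc R) K ≡ count 0 R K + count 1 (suc (suc R)) K
  count-step₁ R K = begin
    count 1 (suc R) K                       ≡⟨ enum-unique (count-enum 1 (suc R) K) (↔-trans (count-enum 0 R K) (↔-sym drop-leaf)) ⟩
    count 0 R K                             ≡⟨ ℕ.+-identityʳ _ ⟨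
    count 0 R K + 0                         ≡⟨ cong (_+_ (count 0 R K)) (count-few-vertices K (ℕ.n<1+n 1)) ⟨
    count 0 R K + count 1 (suc (suc R)) K   ∎
    where
    open ≡-Reasoning
    drop-leaf : Σ Forest (Shaped 1 (suc R) K) ↔ Σ Forest (Shaped 0 R K)
    drop-leaf = restrict-↔ drop (node [] ∷_) drop-shaped
      (λ (shaped s l k) → shaped (cong suc s) (cong suc l) k) drop-leaf-inverse (λ _ → refl)
      shaped-irrelevant shaped-irrelevant
      where
      drop : Forest → Forest
      drop [] = []
      drop (_ ∷ f) = f
      drop-shaped : ∀ {f} → Shaped 1 (suc R) K f → Shaped 0 R K (drop f)
      drop-shaped {node [] ∷ f} (shaped s l k) = shaped (ℕ.suc-injective s) (ℕ.suc-injective l) k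
      drop-shaped {node (node _ ∷ _) ∷ f} (shaped () _ _)
      drop-leaf-inverse : ∀ {f} → Shaped 1 (suc R) K f → node [] ∷ drop f ≡ f
      drop-leaf-inverse {node [] ∷ f} _ = refl
      drop-leaf-inverse {node (node _ ∷ _) ∷ f} (shaped () _ _)

  splitLast : PlaneTree → List PlaneTree → List PlaneTree × PlaneTree
  splitLast x [] = [] , x
  splitLast x (y ∷ ys) = x ∷ proj₁ (splitLast y ys) , proj₂ (splitLast y ys)

  splitLast-∷ʳ : ∀ x xs → proj₁ (splitLast x xs) ∷ʳ proj₂ (splitLast x xs) ≡ x ∷ xs
  splitLast-∷ʳ x [] = refl
  splitLast-∷ʳ x (y ∷ ys) = cong (x ∷_) (splitLast-∷ʳ y ys)

  splitLast-of-∷ʳ : ∀ x xs y → splitLast x (xs ∷ʳ y) ≡ (x ∷ xs , y)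
  splitLast-of-∷ʳ x [] y = refl
  splitLast-of-∷ʳ x (z ∷ zs) y = cong (λ (init , last) → x ∷ init , last) (splitLast-of-∷ʳ z zs y)

  sizes-++ : ∀ xs ys → sizes (xs ++ ys) ≡ sizes xs + sizes ys
  sizes-++ [] ys = refl
  sizes-++ (x ∷ xs) ys = trans (cong (_+_ (size x)) (sizes-++ xs ys)) (sym (ℕ.+-assoc (size x) _ _))

  specialBelows-++ : ∀ xs ys → specialBelows (xs ++ ys) ≡ specialBelows xs + specialBelows ys
  specialBelows-++ [] ys = refl
  specialBelows-++ (x ∷ xs) ys =
    trans (cong (_+_ (specialBelow x)) (specialBelows-++ xs ys)) (sym (ℕ.+-assoc (specialBelow x) _ _))

  leftmostLeaf-∷ʳ : ∀ y ys l → leftmostLeaf ((y ∷ ys) ∷ʳ l) ≡ leftmostLeaf (y ∷ ys)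
  leftmostLeaf-∷ʳ (node []) ys l = refl
  leftmostLeaf-∷ʳ (node (_ ∷ _)) ys l = refl

  sizes-promote : ∀ ys l rest → sizes (node (ys ∷ʳ l) ∷ rest) ≡ sizes (node ys ∷ l ∷ rest)
  sizes-promote ys l rest = cong suc (begin
    sizes (ys ∷ʳ l) + sizes rest                ≡⟨ cong (_+ sizes rest) (sizes-++ ys (l ∷ [])) ⟩
    sizes ys + (size l + 0) + sizes rest        ≡⟨ cong (λ z → sizes ys + z + sizes rest) (ℕ.+-identityʳ (size l)) ⟩
    sizes ys + size l + sizes rest              ≡⟨ ℕ.+-assoc (sizes ys) (size l) (sizes rest) ⟩
    sizes ys + (size l + sizes rest)            ∎)
    where open ≡-Reasoning

  specials-promote : ∀ ys l rest → leftmostLeaf (ys ∷ʳ l) ≡ leftmostLeaf ys →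
    specialBelows (node (ys ∷ʳ l) ∷ rest) ≡ specialBelows (node ys ∷ l ∷ rest)
  specials-promote ys l rest same-leftmost = begin
    leftmostLeaf (ys ∷ʳ l) + specialBelows (ys ∷ʳ l) + specialBelows rest
      ≡⟨ cong₂ (λ a b → a + b + specialBelows rest) same-leftmost (specialBelows-++ ys (l ∷ [])) ⟩
    leftmostLeaf ys + (specialBelows ys + (specialBelow l + 0)) + specialBelows rest
      ≡⟨ cong (λ z → leftmostLeaf ys + (specialBelows ys + z) + specialBelows rest) (ℕ.+-identityʳ (specialBelow l)) ⟩
    leftmostLeaf ys + (specialBelows ys + specialBelow l) + specialBelows rest
      ≡⟨ regroup (leftmostLeaf ys) (specialBelows ys) (specialBelow l) (specialBelows rest) ⟩
    leftmostLeaf ys + specialBelows ys + (specialBelow l + specialBelows rest) ∎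
    where
    open ≡-Reasoning
    regroup : ∀ a b c d → a + (b + c) + d ≡ a + b + (c + d)
    regroup a b c d = trans (cong (_+ d) (sym (ℕ.+-assoc a b c))) (ℕ.+-assoc (a + b) c d)

  promote-shaped : ∀ {N R K} ys l rest → leftmostLeaf (ys ∷ʳ l) ≡ leftmostLeaf ys →
    Shaped N (suc R) K (node (ys ∷ʳ l) ∷ rest) → Shaped N (suc (suc R)) K (node ys ∷ l ∷ rest)
  promote-shaped ys l rest same (shaped s r k) =
    shaped (trans (sym (sizes-promote ys l rest)) s) (cong suc r) (trans (sym (specials-promote ys l rest same)) k)

  demote-shaped : ∀ {N R K} ys l rest → leftmostLeaf (ys ∷ʳ l) ≡ leftmostLeaf ys →
    Shaped N (suc (suc R)) K (node ys ∷ l ∷ rest) → Shaped N (suc R) K (node (ys ∷ʳ l) ∷ rest)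
  demote-shaped ys l rest same (shaped s r k) =
    shaped (trans (sizes-promote ys l rest) s) (ℕ.suc-injective r) (trans (specials-promote ys l rest same) k)

  ShapedPred : ℕ → ℕ → ℕ → Forest → Set
  ShapedPred M R K g = Shaped M R (ℕ.pred K) g × 1 ≤ K

  -- A forest with M+2 vertices and R+1 trees either starts with a leaf
  -- (drop it), or starts with a root whose only child is a leaf, which is
  -- special (drop both), or else the last child of its first tree is
  -- promoted to a tree.  Promotion yields the forests with M+2 vertices and
  -- R+2 trees except those starting with two leaves, which correspond to the
  -- forests with M vertices and R trees by dropping the two leaves.
  module PromoteLastChild (M R K : ℕ) where

    -- the two sides of count-step₂, as predicates on disjoint unions
    Left : Forest ⊎ Forest → Set
    Left (inj₁ f) = Shaped (suc (suc M)) (suc R) K f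
    Left (inj₂ g) = Shaped M R K g

    Right : (Forest ⊎ Forest) ⊎ Forest → Set
    Right (inj₁ (inj₁ f)) = Shaped (suc M) R K f
    Right (inj₁ (inj₂ f)) = Shaped (suc (suc M)) (suc (suc R)) K f
    Right (inj₂ g) = ShapedPred M R K g

    leaf : PlaneTree
    leaf = node []

    -- The clauses producing inj₂ [] only make the maps total: their
    -- arguments never have the required shape.
    promoteLast : List PlaneTree × PlaneTree → Forest → (Forest ⊎ Forest) ⊎ Forest
    promoteLast ([] , node []) rest = inj₂ rest
    promoteLast (ys , l) rest = inj₁ (inj₂ (node ys ∷ l ∷ rest))

    promote : Forest ⊎ Forest → (Forest ⊎ Forest) ⊎ Forest
    promote (inj₁ []) = inj₂ []
    promote (inj₁ (node [] ∷ rest)) = inj₁ (inj₁ rest)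
    promote (inj₁ (node (c ∷ cs) ∷ rest)) = promoteLast (splitLast c cs) rest
    promote (inj₂ g) = inj₁ (inj₂ (leaf ∷ leaf ∷ g))

    demote : (Forest ⊎ Forest) ⊎ Forest → Forest ⊎ Forest
    demote (inj₁ (inj₁ f)) = inj₁ (leaf ∷ f)
    demote (inj₁ (inj₂ (node [] ∷ node [] ∷ g))) = inj₂ g
    demote (inj₁ (inj₂ (node ys ∷ l ∷ rest))) = inj₁ (node (ys ∷ʳ l) ∷ rest)
    demote (inj₁ (inj₂ _)) = inj₂ []
    demote (inj₂ g) = inj₁ (node (leaf ∷ []) ∷ g)

    demote-promoteLast : ∀ p rest → demote (promoteLast p rest) ≡ inj₁ (node (proj₁ p ∷ʳ proj₂ p) ∷ rest)
    demote-promoteLast ([] , node []) rest = refl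
    demote-promoteLast ([] , node (_ ∷ _)) rest = refl
    demote-promoteLast (_ ∷ _ , l) rest = refl

    demote-promote : ∀ {x} → Left x → demote (promote x) ≡ x
    demote-promote {inj₁ []} (shaped () _ _)
    demote-promote {inj₁ (node [] ∷ rest)} _ = refl
    demote-promote {inj₁ (node (c ∷ cs) ∷ rest)} _ =
      trans (demote-promoteLast (splitLast c cs) rest) (cong (λ cs′ → inj₁ (node cs′ ∷ rest)) (splitLast-∷ʳ c cs))
    demote-promote {inj₂ g} _ = refl

    promote-demote : ∀ {y} → Right y → promote (demote y) ≡ y
    promote-demote {inj₁ (inj₁ f)} _ = refl
    promote-demote {inj₁ (inj₂ [])} (shaped _ () _)
    promote-demote {inj₁ (inj₂ (_ ∷ []))} (shaped _ () _)
    promote-demote {inj₁ (inj₂ (node [] ∷ node [] ∷ g))} _ = refl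
    promote-demote {inj₁ (inj₂ (node [] ∷ node (_ ∷ _) ∷ rest))} _ = refl
    promote-demote {inj₁ (inj₂ (node (y ∷ ys) ∷ l ∷ rest))} _ = cong (λ p → promoteLast p rest) (splitLast-of-∷ʳ y ys l)
    promote-demote {inj₂ g} _ = refl

    promoteLast-shaped : ∀ p rest → Left (inj₁ (node (proj₁ p ∷ʳ proj₂ p) ∷ rest)) → Right (promoteLast p rest)
    promoteLast-shaped ([] , node []) rest (shaped s r k) =
      shaped (ℕ.suc-injective (ℕ.suc-injective s)) (ℕ.suc-injective r) (cong ℕ.pred k) , subst (1 ≤_) k (s≤s z≤n)
    promoteLast-shaped ([] , l@(node (_ ∷ _))) rest = promote-shaped [] l rest refl
    promoteLast-shaped (y ∷ ys , l) rest = promote-shaped (y ∷ ys) l rest (leftmostLeaf-∷ʳ y ys l)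

    promote-preserves : ∀ {x} → Left x → Right (promote x)
    promote-preserves {inj₁ []} (shaped () _ _)
    promote-preserves {inj₁ (node [] ∷ rest)} (shaped s r k) = shaped (ℕ.suc-injective s) (ℕ.suc-injective r) k
    promote-preserves {inj₁ (node (c ∷ cs) ∷ rest)} f-shaped = promoteLast-shaped (splitLast c cs) rest
      (subst (λ cs′ → Left (inj₁ (node cs′ ∷ rest))) (sym (splitLast-∷ʳ c cs)) f-shaped)
    promote-preserves {inj₂ g} (shaped s r k) = shaped (cong (suc ∘ suc) s) (cong (suc ∘ suc) r) k

    demote-preserves : ∀ {y} → Right y → Left (demote y)
    demote-preserves {inj₁ (inj₁ f)} (shaped s r k) = shaped (cong suc s) (cong suc r) k
    demote-preserves {inj₁ (inj₂ [])} (shaped _ () _)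
    demote-preserves {inj₁ (inj₂ (_ ∷ []))} (shaped _ () _)
    demote-preserves {inj₁ (inj₂ (node [] ∷ node [] ∷ g))} (shaped s r k) =
      shaped (ℕ.suc-injective (ℕ.suc-injective s)) (ℕ.suc-injective (ℕ.suc-injective r)) k
    demote-preserves {inj₁ (inj₂ (node [] ∷ l@(node (_ ∷ _)) ∷ rest))} = demote-shaped [] l rest refl
    demote-preserves {inj₁ (inj₂ (node (y ∷ ys) ∷ l ∷ rest))} = demote-shaped (y ∷ ys) l rest (leftmostLeaf-∷ʳ y ys l)
    demote-preserves {inj₂ g} (shaped s r k , s≤s z≤n) = shaped (cong (suc ∘ suc) s) (cong suc r) (cong suc k)

    left-irrelevant : Irrelevant Left
    left-irrelevant {inj₁ _} = shaped-irrelevant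
    left-irrelevant {inj₂ _} = shaped-irrelevant

    right-irrelevant : Irrelevant Right
    right-irrelevant {inj₁ (inj₁ _)} = shaped-irrelevant
    right-irrelevant {inj₁ (inj₂ _)} = shaped-irrelevant
    right-irrelevant {inj₂ _} (p , q) (p′ , q′) = cong₂ _,_ (shaped-irrelevant p p′) (ℕ.≤-irrelevant q q′)

    promote-↔ : Σ (Forest ⊎ Forest) Left ↔ Σ ((Forest ⊎ Forest) ⊎ Forest) Right
    promote-↔ = restrict-↔ promote demote promote-preserves demote-preserves demote-promote promote-demote
      left-irrelevant right-irrelevant

  count-pred-enum : ∀ M R K → Fin (shiftℕ (count M R) K) ↔ Σ Forest (ShapedPred M R K)
  count-pred-enum M R zero = mk↔ₛ′ (λ ()) (λ { (_ , _ , ()) }) (λ { (_ , _ , ()) }) (λ ())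
  count-pred-enum M R (suc K) = ↔-trans (count-enum M R K)
    (restrict-↔ id id (λ s → s , s≤s z≤n) proj₁ (λ _ → refl) (λ _ → refl) shaped-irrelevant
      (λ (p , q) (p′ , q′) → cong₂ _,_ (shaped-irrelevant p p′) (ℕ.≤-irrelevant q q′)))

  count-step₂ : ∀ M R K → count (suc (suc M)) (suc R) K + count M R K
              ≡ count (suc M) R K + count (suc (suc M)) (suc (suc R)) K + shiftℕ (count M R) K
  count-step₂ M R K = enum-unique
    (↔-trans (enum-⊎ (count-enum _ _ K) (count-enum M R K)) (↔-trans (↔-sym Σ-distribʳ-⊎) promote-↔))
    (↔-trans (enum-⊎ (enum-⊎ (count-enum _ _ K) (count-enum _ _ K)) (count-pred-enum M R K))
             (↔-sym (↔-trans Σ-distribʳ-⊎ (Σ-distribʳ-⊎ ⊎-cong ↔-refl))))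
    where open PromoteLastChild M R K

module Assembly where

  open import Data.Nat as ℕ using (zero; suc; _<_; s≤s; _∸_)
  import Data.Nat.Properties as ℕ
  open import Data.Integer using (0ℤ; -_; _*_; _+_)
  open import Data.Integer.Properties using (pos-+; [+m]-[+n]≡m⊖n; ⊖-≥; ⊖-<)
  open import Data.List using (length)
  open import Data.Fin as Fin using (toℕ; fromℕ<)
  open import Data.Fin.Properties using (toℕ-fromℕ<; toℕ-injective)
  open import Data.Product using (_,_)
  open import Function using (_∘_)
  open import Function.Bundles using (mk↔ₛ′)
  open import Function.Properties.Inverse using (↔-trans)
  open import Relation.Binary.PropositionalEquality
  open import Data.Nat.Combinatorics using (_C_)
  open import Relation.Nullary using (yes; no; contradiction)
  open Binomials using (binom; binom≡C; ballot; catalan≡ballot)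
  open Sums using (∑; σ; ∑-cong′)
  open Coefficients using (coeff-fd00)
  open Moments using (module ForestMoments)
  open Finiteness using (∑ℕ; enum-∑; restrict-↔)
  open Forests
  open ≡-Reasoning

  pos-∑ : ∀ n g → + ∑ℕ n g ≡ ∑[ i < n ] (+ g i)
  pos-∑ zero g = refl
  pos-∑ (suc n) g = trans (pos-+ (g 0) _) (cong (_+_ (+ g 0)) (pos-∑ n (g ∘ suc)))

  open ForestMoments count count-empty count-no-trees count-few-vertices count-few-specials count-step₁ count-step₂

  Sized : ℕ → ℕ → Forest → Set
  Sized n k f = (sizes f ≡ n) × (specialBelows f ≡ k)

  forests-by-trees : ∀ n k → Σ (Fin (suc n)) (λ R → Σ Forest (Shaped n (toℕ R) k)) ↔ Σ Forest (Sized n k)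
  forests-by-trees n k = mk↔ₛ′
    (λ (_ , f , shaped s _ k) → f , s , k)
    (λ (f , s , k) → fromℕ< (trees< f s) , f , shaped s (sym (toℕ-fromℕ< (trees< f s))) k)
    (λ _ → refl)
    (λ (R , f , shaped s r k) → same-trees (toℕ-injective (trans (toℕ-fromℕ< (trees< f s)) r)))
    where
    trees< : ∀ f → sizes f ≡ n → length f < suc n
    trees< f s = s≤s (subst (length f ≤_) s (length≤sizes f))
    same-trees : ∀ {R R′ f} {p : Shaped n (toℕ R) k f} {q : Shaped n (toℕ R′) k f} → R ≡ R′ →
      _≡_ {A = Σ (Fin (suc n)) (λ R → Σ Forest (Shaped n (toℕ R) k))} (R , f , p) (R′ , f , q)
    same-trees {p = p} {q} refl = cong (λ q → _ , _ , q) (shaped-irrelevant p q)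

  trees-forests : ∀ n k → Σ Forest (Sized n k) ↔ Σ PlaneTree (λ t → (size t ≡ suc n) × (special0 t ≡ k))
  trees-forests n k = restrict-↔ node children
    (λ (s , k) → cong suc s , k) (λ { {node f} (s , k) → ℕ.suc-injective s , k })
    (λ _ → refl) (λ { {node f} _ → refl })
    (λ (s , k) (s′ , k′) → cong₂ _,_ (ℕ.≡-irrelevant s s′) (ℕ.≡-irrelevant k k′))
    (λ (s , k) (s′ , k′) → cong₂ _,_ (ℕ.≡-irrelevant s s′) (ℕ.≡-irrelevant k k′))
    where children : PlaneTree → Forest
          children (node f) = f

  trees-enum : ∀ n k → Fin (∑ℕ (suc n) (λ R → count n R k)) ↔ Σ PlaneTree (λ t → (size t ≡ suc n) × (special0 t ≡ k))
  trees-enum n k = ↔-trans (enum-∑ (suc n) (λ R → count n R k) (λ R → Σ Forest (Shaped n R k)) (λ R → count-enum n R k))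
    (↔-trans (forests-by-trees n k) (trees-forests n k))

  coefficient : ∀ n k → coeffℤ (fd00 (suc n)) (+ suc n - + k) ≡ total n k
  coefficient n k with k ℕ.≤? suc n
  ... | yes k≤1+n = begin
    coeffℤ (fd00 (suc n)) (+ suc n - + k)
      ≡⟨ cong (coeffℤ (fd00 (suc n))) (trans ([+m]-[+n]≡m⊖n (suc n) k) (⊖-≥ k≤1+n)) ⟩
    coeff (fd00 (suc n)) (suc n ∸ k)
      ≡⟨ coeff-fd00 k≤1+n ⟩
    ∑[ m < suc n ] (+ (catalan (n ∸ m) ℕ.* ((n ∸ m) C m)) * σ m k)
      ≡⟨ ∑-cong′ (suc n) (λ m → cong (λ z → + z * σ m k)
           (cong₂ ℕ._*_ (catalan≡ballot (n ∸ m)) (sym (binom≡C (n ∸ m) m)))) ⟩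
    ∑[ m < suc n ] (+ (ballot (n ∸ m) 0 ℕ.* binom (n ∸ m) m) * σ m k)
      ≡⟨ total-inverted n k ⟩
    total n k ∎
  ... | no k≰1+n = begin
    coeffℤ (fd00 (suc n)) (+ suc n - + k)
      ≡⟨ cong (coeffℤ (fd00 (suc n))) (trans ([+m]-[+n]≡m⊖n (suc n) k) (⊖-< 1+n<k)) ⟩
    coeffℤ (fd00 (suc n)) (- + (k ∸ suc n))
      ≡⟨ negative-index (k ∸ suc n) (ℕ.m>n⇒m∸n≢0 1+n<k) ⟩
    0ℤ
      ≡⟨ total-vanish (ℕ.<-trans (ℕ.n<1+n n) 1+n<k) ⟨
    total n k ∎
    where
    1+n<k = ℕ.≰⇒> k≰1+n
    negative-index : ∀ e → e ≢ 0 → coeffℤ (fd00 (suc n)) (- + e) ≡ 0ℤ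
    negative-index zero e≢0 = contradiction refl e≢0
    negative-index (suc e) _ = refl

corollary3p4 : (d : ℕ) → d ≥ 1 → (k : ℕ) →
    Σ ℕ (λ N → (coeffℤ (fd00 d) (+ d - + k) ≡ + N)
    × (Fin N ↔ Σ PlaneTree (λ t → (size t ≡ d) × (special0 t ≡ k))))
corollary3p4 (suc n) _ k = ∑ℕ (suc n) (λ R → count n R k)
  , trans (coefficient n k) (sym (pos-∑ (suc n) (λ R → count n R k)))
  , trees-enum n k
  where
  open Finiteness using (∑ℕ)
  open Forests using (count)
  open Assembly
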